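{- Let $f\ge 1$ be an integer. Then $S_d(3f+1,f)=3d$. That is, for $3f+1$ robots, at most $f$ of which are byzantine faulty: there is a search algorithm whose search time for a target at (unknown) distance $d$ from the origin is at most $3d$ for every $d>0$; and for every $d>0$, every search algorithm has (worst-case) search time at least $3d$ for a target at distance $d$.
   Context: Model. $n$ robots with distinct identities start at time $0$ at the origin of the real line and move along the line with speed at most $1$, changing direction or speed at no cost. A target lies at an unknown point at distance $d>0$ from the origin, i.e. at $d$ or $-d$, with $d$ unknown to the robots. At most $f$ robots are faulty; the bound $f$ is known, but not which robots are faulty. A search algorithm assigns each robot a trajectory, known to all robots; a robot's further motion may depend on the messages broadcast so far (computation and communication take no time). A robot detects whether the target is at a point only by being there. The only messages are announcements "the target is here", heard instantly by all robots at any distance; each message automatically carries the true identity and true current location of its sender. A robot visiting a point silently is taken to claim that the target is not there. Reliable (non-faulty) robots follow the algorithm and report truthfully. Faulty robots are controlled by an adversary: they may stay silent at the target or announce the target where it is not; a faulty robot that broadcasts while off its assigned trajectory is thereby detected as faulty. The search is completed at the first time when some reliable robot has visited the target and announced it and all reliable robots can be certain of its location (every scenario with at most $f$ faulty robots consistent with the messages so far has the target at that location). For an algorithm, the search time $S_d(n,f)$ is the worst-case completion time over both positions $\pm d$ of the target, all choices of at most $f$ faulty robots, and all behaviours of the faulty robots. -}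

module Defs where

open import Algebra.Structures using (IsCommutativeRing)
open import Data.Bool.Base using (Bool; true; if_then_else_)
open import Data.Fin.Base using (Fin)
open import Data.Fin.Subset using (Subset; _∈_; _∉_; ∣_∣)
open import Data.Maybe.Base using (Maybe; just; nothing)
open import Data.Nat.Base as ℕ using (ℕ)
open import Data.Product.Base using (_×_; ∃; ∃-syntax)
open import Data.Sum.Base using (_⊎_)
open import Function.Bundles using (_⇔_)
open import Relation.Binary.PropositionalEquality.Core using (_≡_; _≢_)
open import Relation.Binary.Structures using (IsTotalOrder)
import Relation.Binary.Construct.NonStrictToStrict as NonStrictToStrict

-- The real numbers, axiomatised as a Dedekind-complete ordered field.
record CompleteOrderedField : Set₁ where
  infix  4 _≤_
  infixl 7 _*_
  infixl 6 _+_ _-_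
  infix  8 -_
  field
    Carrier           : Set
    _≤_               : Carrier → Carrier → Set
    _+_ _*_           : Carrier → Carrier → Carrier
    -_                : Carrier → Carrier
    0# 1#             : Carrier
    isCommutativeRing : IsCommutativeRing _≡_ _+_ _*_ -_ 0# 1#
    0≢1               : 0# ≢ 1#
    inverse           : ∀ x → x ≢ 0# → ∃[ y ] x * y ≡ 1#
    isTotalOrder      : IsTotalOrder _≡_ _≤_
    +-monoʳ-≤         : ∀ z {x y} → x ≤ y → z + x ≤ z + y
    *-nonNeg          : ∀ {x y} → 0# ≤ x → 0# ≤ y → 0# ≤ x * y
    supremum          : (P : Carrier → Set) → ∃ P →
                        (∃[ b ] ∀ x → P x → x ≤ b) →
                        ∃[ s ] (∀ x → P x → x ≤ s) ×
                               (∀ b → (∀ x → P x → x ≤ b) → s ≤ b)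

  open NonStrictToStrict _≡_ _≤_ public using (_<_)

  _-_ : Carrier → Carrier → Carrier
  x - y = x + - y

module LineSearch (real : CompleteOrderedField) where

  open CompleteOrderedField real public
    using (0#; _<_) renaming (Carrier to ℝ)
  open CompleteOrderedField real using (_≤_; _+_; _-_; -_)

  thrice : ℝ → ℝ
  thrice d = d + d + d

  -- Motions and message histories are functions on all of ℝ, but only their
  -- values at times t ≥ 0 are ever constrained or inspected.
  Motion : Set
  Motion = ℝ → ℝ

  record IsMotion (p : Motion) : Set where
    field
      start   : p 0# ≡ 0#
      speed≤1 : ∀ {s t} → 0# ≤ s → s ≤ t →
                p t - p s ≤ t - s × p s - p t ≤ t - s

  -- `h r t ≡ just p`: at time t robot r, located at p, broadcasts "the target
  -- is here".  `h r t ≡ nothing`: robot r is silent at time t.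
  History : ℕ → Set
  History n = Fin n → ℝ → Maybe ℝ

  AgreeUpTo : ∀ {n} → ℝ → History n → History n → Set
  AgreeUpTo t h h′ = ∀ r {s} → 0# ≤ s → s ≤ t → h r s ≡ h′ r s

  record Strategy (n : ℕ) : Set where
    field
      trajectory : History n → Fin n → Motion
      isMotion   : ∀ h r → IsMotion (trajectory h r)
      causal     : ∀ {h h′ t} → 0# ≤ t → AgreeUpTo t h h′ →
                   ∀ r → trajectory h r t ≡ trajectory h′ r t

  broadcasts : ∀ {n} → (Fin n → Motion) → (Fin n → ℝ → Bool) → History n
  broadcasts motion announces r t =
    if announces r t then just (motion r t) else nothing

  -- A complete execution.  Faulty robots are only bound by the speed limit
  -- and by the authenticity of the sender and location of their messages.
  record Scenario {n : ℕ} (σ : Strategy n) (f : ℕ) : Set where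
    open Strategy σ using (trajectory)
    field
      target    : ℝ
      target≢0  : target ≢ 0#
      faulty    : Subset n
      ∣faulty∣≤f : ∣ faulty ∣ ℕ.≤ f
      motion    : Fin n → Motion
      isMotion  : ∀ r → IsMotion (motion r)
      announces : Fin n → ℝ → Bool

    history : History n
    history = broadcasts motion announces

    field
      follows  : ∀ {r t} → r ∉ faulty → 0# ≤ t →
                 motion r t ≡ trajectory history r t
      truthful : ∀ {r t} → r ∉ faulty → 0# ≤ t →
                 announces r t ≡ true ⇔ motion r t ≡ target

  -- In continuous time a causal strategy can be self-contradictory ("leave the
  -- target at time t iff I have been announcing it immediately after t").  An
  -- algorithm has to determine an execution whatever the target, the faulty
  -- robots and their behaviour; otherwise worst cases could range over nothing.
  WellPosed : ∀ {n} → Strategy n → ℕ → Set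
  WellPosed {n} σ f =
    ∀ (x : ℝ) → x ≢ 0# →
    ∀ (F : Subset n) → ∣ F ∣ ℕ.≤ f →
    ∀ (m : Fin n → Motion) → (∀ r → IsMotion (m r)) →
    ∀ (a : Fin n → ℝ → Bool) →
    ∃[ S ] let open Scenario {σ = σ} {f = f} S in
      target ≡ x × faulty ≡ F ×
      (∀ {r t} → r ∈ F → 0# ≤ t → motion r t ≡ m r t × announces r t ≡ a r t)

  record SearchAlgorithm (n f : ℕ) : Set where
    field
      strategy  : Strategy n
      wellPosed : WellPosed strategy f

  module _ {n f : ℕ} {σ : Strategy n} where
    open Scenario {n} {σ} {f}

    Certain : Scenario σ f → ℝ → Set
    Certain S t = ∀ (S′ : Scenario σ f) →
                  AgreeUpTo t (history S) (history S′) → target S′ ≡ target S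

    CompletedBy : Scenario σ f → ℝ → Set
    CompletedBy S t =
      (∃[ r ] ∃[ s ] r ∉ faulty S × 0# ≤ s × s ≤ t ×
                     history S r s ≡ just (target S))
      × Certain S t

    AtDistance : ℝ → Scenario σ f → Set
    AtDistance d S = target S ≡ d ⊎ target S ≡ - d

  module _ {n f : ℕ} (A : SearchAlgorithm n f) where
    open SearchAlgorithm A

    SearchTimeAtMost : ℝ → ℝ → Set
    SearchTimeAtMost d T =
      ∀ (S : Scenario strategy f) → AtDistance d S → CompletedBy S T

    -- The search time is a supremum, possibly infinite: T is a lower bound for
    -- it when T is below each of its upper bounds.
    SearchTimeAtLeast : ℝ → ℝ → Set
    SearchTimeAtLeast d T = ∀ T′ → SearchTimeAtMost d T′ → T ≤ T′

{-# OPTIONS --safe #-}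

-- Lower bound.  No robot visits both d and − d before time 3d.  Run the algorithm with all
-- robots silent, and let τ be the time by which both d and − d have been visited by more
-- than f robots, say with d last.  Put the target at d, and let the faulty robots be those
-- that reach d before τ, filled up to f, and silent.  At most 3f + 1 − (f + 1) − f = f robots
-- can announce d before 3d, so it remains possible that exactly those are lying.
--
-- Upper bound.  Two teams walk in opposite directions at full speed, and every robot that
-- announces something on its way is from then on discounted.  With g undetected faults left
-- only about 3g / 2 robots per team go on; the others turn back.  Suppose that two scenarios
-- with targets x and y, |x| ≤ |y|, cannot be told apart up to time 3|x|.  Robots discounted
-- before time |x| are faulty in both.  A robot reaching x at time |x|, or at time 3|x|
-- because it turned back at time |x|, is faulty in the second if it announces x and in the
-- first if it does not.  There are too many such robots for the remaining budgets 2g.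

module Submission where

open import Algebra.Bundles using (CommutativeMonoid; CommutativeRing)
import Algebra.Properties.CommutativeSemigroup
import Algebra.Properties.Group
import Algebra.Properties.Monoid.Mult
import Algebra.Properties.Ring
open import Axiom.ExcludedMiddle using (ExcludedMiddle)
open import Data.Bool.Base using (Bool; true; false; not; if_then_else_)
open import Data.Bool.Properties using (not-involutive; not-¬)
open import Data.Fin.Base using (Fin; zero; suc)
open import Data.Fin.Subset
  using (Subset; inside; outside; _∈_; _∉_; _⊆_; _∪_; _∩_; _─_; ∁; ∣_∣; Empty)
  renaming (⊥ to ∅; ⊤ to full)
open import Data.Fin.Subset.Properties
  using (_∈?_; nonempty?; ⊥⊆; ⊆-antisym; ∣⊥∣≡0; ∣⊤∣≡n; ∣∁p∣≡n∸∣p∣; p⊆q⇒∣p∣≤∣q∣; Empty-unique;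
         drop-∷-⊆; s⊆s; out⊆; x∈p∪q⁺; x∈p∪q⁻; x∈p∩q⁺; x∈p∩q⁻; p⊆p∪q; p─q⊆p;
         x∈p∧x∉q⇒x∈p─q; x∈∁p⇒x∉p; x∉p⇒x∈∁p; x∉∁p⇒x∈p)
open import Data.Maybe.Base using (just; nothing)
open import Data.Maybe.Properties using (just-injective)
open import Data.Nat.Base as ℕ using (ℕ; zero; suc; pred; _∸_; ⌊_/2⌋; ⌈_/2⌉; z≤n; s≤s)
import Data.Nat.Properties as ℕ
import Data.Nat.Solver
open import Data.Product.Base using (_×_; _,_; proj₁; proj₂; ∃; ∃-syntax; Σ-syntax)
open import Data.Sum.Base using (_⊎_; inj₁; inj₂; [_,_]′)
open import Data.Vec.Base as Vec using (Vec; []; _∷_; here; there; lookup; replicate; zipWith; allFin)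
open import Data.Vec.N-ary using (N-ary; _$ⁿ_)
open import Data.Vec.Properties using (lookup⇒[]=; []=⇒lookup; lookup∘tabulate)
open import Function.Base using (_∘_)
open import Function.Bundles using (_⇔_; mk⇔; Equivalence)
open import Level using (0ℓ)
open import Relation.Binary.PropositionalEquality
open import Relation.Binary.Structures using (IsTotalOrder)
open import Relation.Nullary using (¬_; yes; no; does; contradiction)
open import Relation.Nullary.Decidable using (dec-true; decidable-stable)
open import Defs


-- Cardinalities of finite sets and the arithmetic of quotas.

module _ where
  open import Data.Nat.Base using (_+_; _≤_)

  ∣p∪q∣+∣p∩q∣≡∣p∣+∣q∣ : ∀ {n} (p q : Subset n) → ∣ p ∪ q ∣ + ∣ p ∩ q ∣ ≡ ∣ p ∣ + ∣ q ∣
  ∣p∪q∣+∣p∩q∣≡∣p∣+∣q∣ []            []            = refl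
  ∣p∪q∣+∣p∩q∣≡∣p∣+∣q∣ (outside ∷ p) (outside ∷ q) = ∣p∪q∣+∣p∩q∣≡∣p∣+∣q∣ p q
  ∣p∪q∣+∣p∩q∣≡∣p∣+∣q∣ (inside  ∷ p) (outside ∷ q) = cong suc (∣p∪q∣+∣p∩q∣≡∣p∣+∣q∣ p q)
  ∣p∪q∣+∣p∩q∣≡∣p∣+∣q∣ (outside ∷ p) (inside  ∷ q) =
    trans (cong suc (∣p∪q∣+∣p∩q∣≡∣p∣+∣q∣ p q)) (sym (ℕ.+-suc ∣ p ∣ ∣ q ∣))
  ∣p∪q∣+∣p∩q∣≡∣p∣+∣q∣ (inside  ∷ p) (inside  ∷ q) =
    cong suc (trans (ℕ.+-suc _ _)
      (trans (cong suc (∣p∪q∣+∣p∩q∣≡∣p∣+∣q∣ p q)) (sym (ℕ.+-suc ∣ p ∣ ∣ q ∣))))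

  ∣p─q∣+∣q∣≡∣p∪q∣ : ∀ {n} (p q : Subset n) → ∣ p ─ q ∣ + ∣ q ∣ ≡ ∣ p ∪ q ∣
  ∣p─q∣+∣q∣≡∣p∪q∣ []            []            = refl
  ∣p─q∣+∣q∣≡∣p∪q∣ (outside ∷ p) (outside ∷ q) = ∣p─q∣+∣q∣≡∣p∪q∣ p q
  ∣p─q∣+∣q∣≡∣p∪q∣ (inside  ∷ p) (outside ∷ q) = cong suc (∣p─q∣+∣q∣≡∣p∪q∣ p q)
  ∣p─q∣+∣q∣≡∣p∪q∣ (outside ∷ p) (inside  ∷ q) =
    trans (ℕ.+-suc _ _) (cong suc (∣p─q∣+∣q∣≡∣p∪q∣ p q))
  ∣p─q∣+∣q∣≡∣p∪q∣ (inside  ∷ p) (inside  ∷ q) =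
    trans (ℕ.+-suc _ _) (cong suc (∣p─q∣+∣q∣≡∣p∪q∣ p q))

  x∈p─q⇒x∉q : ∀ {n} (p q : Subset n) {x} → x ∈ p ─ q → x ∉ q
  x∈p─q⇒x∉q (_ ∷ p) (inside  ∷ q) (there x∈) (there x∈q) = x∈p─q⇒x∉q p q x∈ x∈q
  x∈p─q⇒x∉q (_ ∷ p) (outside ∷ q) (there x∈) (there x∈q) = x∈p─q⇒x∉q p q x∈ x∈q

  ∣p∣≤∣p─q∣+∣q∣ : ∀ {n} (p q : Subset n) → ∣ p ∣ ≤ ∣ p ─ q ∣ + ∣ q ∣
  ∣p∣≤∣p─q∣+∣q∣ p q = subst (∣ p ∣ ≤_) (sym (∣p─q∣+∣q∣≡∣p∪q∣ p q)) (p⊆q⇒∣p∣≤∣q∣ (p⊆p∪q {p = p} q))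

  disjoint⇒∣p∣+∣q∣≤∣p∪q∣ : ∀ {n} (p q : Subset n) → (∀ {x} → x ∈ p → x ∉ q) →
                           ∣ p ∣ + ∣ q ∣ ≤ ∣ p ∪ q ∣
  disjoint⇒∣p∣+∣q∣≤∣p∪q∣ {n} p q disjoint = ℕ.≤-reflexive (begin
    ∣ p ∣ + ∣ q ∣           ≡⟨ ∣p∪q∣+∣p∩q∣≡∣p∣+∣q∣ p q ⟨
    ∣ p ∪ q ∣ + ∣ p ∩ q ∣   ≡⟨ cong (λ r → ∣ p ∪ q ∣ + ∣ r ∣) (Empty-unique empty) ⟩
    ∣ p ∪ q ∣ + ∣ ∅ {n} ∣   ≡⟨ cong (∣ p ∪ q ∣ +_) (∣⊥∣≡0 n) ⟩
    ∣ p ∪ q ∣ + 0           ≡⟨ ℕ.+-identityʳ _ ⟩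
    ∣ p ∪ q ∣               ∎)
    where
    open ≡-Reasoning
    empty : Empty (p ∩ q)
    empty (x , x∈p∩q) with x∈p , x∈q ← x∈p∩q⁻ p q x∈p∩q = disjoint x∈p x∈q

  ∣q∣<∣p∣⇒p⊈q : ∀ {n} (p q : Subset n) → ∣ q ∣ ℕ.< ∣ p ∣ → ∃[ x ] x ∈ p × x ∉ q
  ∣q∣<∣p∣⇒p⊈q p q ∣q∣<∣p∣ with nonempty? (p ─ q)
  ... | yes (x , x∈p─q) = x , p─q⊆p p q x∈p─q , x∈p─q⇒x∉q p q x∈p─q
  ... | no empty = contradiction (p⊆q⇒∣p∣≤∣q∣ p⊆q) (ℕ.<⇒≱ ∣q∣<∣p∣)
    where
    p⊆q : p ⊆ q
    p⊆q {x} x∈p with x ∈? q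
    ... | yes x∈q = x∈q
    ... | no  x∉q = contradiction (x , x∈p∧x∉q⇒x∈p─q x∈p x∉q) empty

  -- `d` lies in `p ∩ q` and is counted twice on the right, `e` at least once. With two fault sets
  -- for `p` and `q`, robots faulty in both scenarios are charged double.
  count-twice : ∀ {n} {d e p q : Subset n} → d ⊆ p → d ⊆ q → (∀ {x} → x ∈ e → x ∈ p ⊎ x ∈ q) →
                (∀ {x} → x ∈ d → x ∉ e) → ∣ d ∣ + (∣ d ∣ + ∣ e ∣) ≤ ∣ p ∣ + ∣ q ∣
  count-twice {d = d} {e} {p} {q} d⊆p d⊆q e⊆ disjoint = begin
    ∣ d ∣ + (∣ d ∣ + ∣ e ∣)     ≤⟨ ℕ.+-mono-≤ (p⊆q⇒∣p∣≤∣q∣ d⊆p∩q)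
                                     (ℕ.≤-trans (disjoint⇒∣p∣+∣q∣≤∣p∪q∣ d e disjoint)
                                       (p⊆q⇒∣p∣≤∣q∣ d∪e⊆p∪q)) ⟩
    ∣ p ∩ q ∣ + ∣ p ∪ q ∣       ≡⟨ ℕ.+-comm ∣ p ∩ q ∣ _ ⟩
    ∣ p ∪ q ∣ + ∣ p ∩ q ∣       ≡⟨ ∣p∪q∣+∣p∩q∣≡∣p∣+∣q∣ p q ⟩
    ∣ p ∣ + ∣ q ∣               ∎
    where
    open ℕ.≤-Reasoning
    d⊆p∩q : d ⊆ p ∩ q
    d⊆p∩q x∈d = x∈p∩q⁺ (d⊆p x∈d , d⊆q x∈d)
    d∪e⊆p∪q : d ∪ e ⊆ p ∪ q
    d∪e⊆p∪q x∈ = x∈p∪q⁺ ([ inj₁ ∘ d⊆p , e⊆ ]′ (x∈p∪q⁻ d e x∈))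

  -- Choosing by least index depends on the set alone and is compatible with inclusion in the sense
  -- of `first-mono`.
  first : ∀ {n} → ℕ → Subset n → Subset n
  first zero    p             = ∅
  first (suc m) []            = []
  first (suc m) (outside ∷ p) = outside ∷ first (suc m) p
  first (suc m) (inside  ∷ p) = inside ∷ first m p

  first⊆ : ∀ {n} m (p : Subset n) → first m p ⊆ p
  first⊆ zero    p             = ⊥⊆
  first⊆ (suc m) []            ()
  first⊆ (suc m) (outside ∷ p) = s⊆s (first⊆ (suc m) p)
  first⊆ (suc m) (inside  ∷ p) = s⊆s (first⊆ m p)

  ∣first∣≤ : ∀ {n} m (p : Subset n) → ∣ first m p ∣ ≤ m
  ∣first∣≤ {n} zero p           = ℕ.≤-reflexive (∣⊥∣≡0 n)
  ∣first∣≤ (suc m) []            = z≤n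
  ∣first∣≤ (suc m) (outside ∷ p) = ∣first∣≤ (suc m) p
  ∣first∣≤ (suc m) (inside  ∷ p) = s≤s (∣first∣≤ m p)

  ≤∣first∣ : ∀ {n} m (p : Subset n) → m ≤ ∣ p ∣ → m ≤ ∣ first m p ∣
  ≤∣first∣ zero    p             _         = z≤n
  ≤∣first∣ (suc m) (outside ∷ p) m≤        = ≤∣first∣ (suc m) p m≤
  ≤∣first∣ (suc m) (inside  ∷ p) (s≤s m≤)  = s≤s (≤∣first∣ m p m≤)

  ∣first∣ : ∀ {n} m (p : Subset n) → m ≤ ∣ p ∣ → ∣ first m p ∣ ≡ m
  ∣first∣ m p m≤∣p∣ = ℕ.≤-antisym (∣first∣≤ m p) (≤∣first∣ m p m≤∣p∣)

  -- Deleting elements of `p` moves a remaining one up by at most `∣ p ∣ - ∣ q ∣` places; the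
  -- hypothesis says that `m` exceeds `k` by at least that much.
  first-mono : ∀ {n} m k (p q : Subset n) → q ⊆ p → ∣ p ∣ + k ≤ ∣ q ∣ + m → first k q ⊆ first m p
  first-mono m zero    p q _ _ = ⊥⊆
  first-mono zero (suc k) p q q⊆p le =
    contradiction (ℕ.≤-trans (ℕ.≤-trans (ℕ.≤-reflexive (sym (ℕ.+-suc ∣ p ∣ k))) le)
                             (ℕ.≤-trans (ℕ.≤-reflexive (ℕ.+-identityʳ _)) (p⊆q⇒∣p∣≤∣q∣ q⊆p)))
                  (ℕ.m+n≮m ∣ p ∣ k)
  first-mono (suc m) (suc k) [] [] _ _ ()
  first-mono (suc m) (suc k) (outside ∷ p) (outside ∷ q) q⊆p le =
    s⊆s (first-mono (suc m) (suc k) p q (drop-∷-⊆ q⊆p) le)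
  first-mono (suc m) (suc k) (inside ∷ p) (outside ∷ q) q⊆p le =
    out⊆ (first-mono m (suc k) p q (drop-∷-⊆ q⊆p) (ℕ.s≤s⁻¹ (subst (suc (∣ p ∣ + suc k) ≤_) (ℕ.+-suc ∣ q ∣ m) le)))
  first-mono (suc m) (suc k) (inside ∷ p) (inside ∷ q) q⊆p le =
    s⊆s (first-mono m k p q (drop-∷-⊆ q⊆p)
      (ℕ.s≤s⁻¹ (subst₂ _≤_ (ℕ.+-suc ∣ p ∣ k) (ℕ.+-suc ∣ q ∣ m) (ℕ.s≤s⁻¹ le))))
  first-mono (suc m) (suc k) (outside ∷ p) (inside ∷ q) q⊆p le with () ← q⊆p here

  between : ∀ {n} (p r : Subset n) k → p ⊆ r → ∣ p ∣ ≤ k → k ≤ ∣ r ∣ →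
            ∃[ q ] p ⊆ q × q ⊆ r × ∣ q ∣ ≡ k
  between p r k p⊆r ∣p∣≤k k≤∣r∣ = p ∪ e , p⊆p∪q e , q⊆r , (begin
    ∣ p ∪ e ∣            ≡⟨ ℕ.≤-antisym ∣p∪e∣≤ (disjoint⇒∣p∣+∣q∣≤∣p∪q∣ p e disjoint) ⟩
    ∣ p ∣ + ∣ e ∣        ≡⟨ cong (∣ p ∣ +_) (∣first∣ (k ∸ ∣ p ∣) (r ─ p) enough) ⟩
    ∣ p ∣ + (k ∸ ∣ p ∣)  ≡⟨ ℕ.m+[n∸m]≡n ∣p∣≤k ⟩
    k                    ∎)
    where
    open ≡-Reasoning
    e = first (k ∸ ∣ p ∣) (r ─ p)
    e⊆ = first⊆ (k ∸ ∣ p ∣) (r ─ p)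
    disjoint : ∀ {x} → x ∈ p → x ∉ e
    disjoint x∈p x∈e = x∈p─q⇒x∉q r p (e⊆ x∈e) x∈p
    ∣p∪e∣≤ : ∣ p ∪ e ∣ ≤ ∣ p ∣ + ∣ e ∣
    ∣p∪e∣≤ = subst (∣ p ∪ e ∣ ≤_) (∣p∪q∣+∣p∩q∣≡∣p∣+∣q∣ p e) (ℕ.m≤m+n _ _)
    q⊆r : p ∪ e ⊆ r
    q⊆r x∈ = [ p⊆r , p─q⊆p r p ∘ e⊆ ]′ (x∈p∪q⁻ p e x∈)
    enough : k ∸ ∣ p ∣ ≤ ∣ r ─ p ∣
    enough = ℕ.m≤n+o⇒m∸n≤o k ∣ p ∣ (ℕ.≤-trans k≤∣r∣ (subst (∣ r ∣ ≤_) (ℕ.+-comm _ ∣ p ∣) (∣p∣≤∣p─q∣+∣q∣ r p)))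

  -- For `g ≥ 1` these are the two halves of `g - 1`, rounded up on side `true` and down on side
  -- `false`; both vanish at `g = 0`.
  half : Bool → ℕ → ℕ
  half true  g = ⌊ g /2⌋
  half false g = ⌊ pred g /2⌋

  half-mono : ∀ b {j g} → j ≤ g → half b j ≤ half b g
  half-mono true  = ℕ.⌊n/2⌋-mono
  half-mono false = ℕ.⌊n/2⌋-mono ∘ ℕ.pred-mono-≤

  half-not : ∀ b g → half b g + half (not b) g ≡ pred g
  half-not true  zero    = refl
  half-not false zero    = refl
  half-not true  (suc g) = trans (ℕ.+-comm ⌈ g /2⌉ ⌊ g /2⌋) (ℕ.⌊n/2⌋+⌈n/2⌉≡n g)
  half-not false (suc g) = ℕ.⌊n/2⌋+⌈n/2⌉≡n g

  half-not≤half : ∀ b {j g} → j ≤ pred g → half (not b) j ≤ half b g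
  half-not≤half true  {j} {g} j≤ = ℕ.⌊n/2⌋-mono (ℕ.≤-trans ℕ.pred[n]≤n (ℕ.≤-trans j≤ ℕ.pred[n]≤n))
  half-not≤half false j≤ = ℕ.⌊n/2⌋-mono j≤

  -- The number of robots kept on side b while at most g faults are undetected.  By half-not
  -- the two quotas add up to 3g + 1 (g ≥ 1), so that initially every robot is kept.
  quota : Bool → ℕ → ℕ
  quota b g = suc (g + half b g)

  -- Adding back the `k` flagged robots undoes the truncated subtraction. The total exceeds `f`, so
  -- kept and flagged robots together cannot all be faulty.
  quota-∸ : ∀ b {f k} → k ≤ f → quota b (f ∸ k) + k ≡ suc (f + half b (f ∸ k))
  quota-∸ b {f} {k} k≤f = cong suc (begin
    f ∸ k + h + k     ≡⟨ ℕ.+-assoc (f ∸ k) h k ⟩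
    f ∸ k + (h + k)   ≡⟨ cong (f ∸ k +_) (ℕ.+-comm h k) ⟩
    f ∸ k + (k + h)   ≡⟨ ℕ.+-assoc (f ∸ k) k h ⟨
    f ∸ k + k + h     ≡⟨ cong (_+ h) (ℕ.m∸n+n≡m k≤f) ⟩
    f + h             ∎)
    where
    open ≡-Reasoning
    h = half b (f ∸ k)

  -- Each additional flag lowers the quota by at least one, as `half` is monotone. Hence unflagged
  -- robots suffice to fill the quota, and nobody recalled is sent out again.
  quota-drop : ∀ b {f k l} → k ≤ l → l ≤ f → quota b (f ∸ l) + l ≤ quota b (f ∸ k) + k
  quota-drop b {f} {k} {l} k≤l l≤f = begin
    quota b (f ∸ l) + l        ≡⟨ quota-∸ b l≤f ⟩
    suc (f + half b (f ∸ l))   ≤⟨ s≤s (ℕ.+-monoʳ-≤ f (half-mono b (ℕ.∸-monoʳ-≤ f k≤l))) ⟩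
    suc (f + half b (f ∸ k))   ≡⟨ quota-∸ b (ℕ.≤-trans k≤l l≤f) ⟨
    quota b (f ∸ k) + k        ∎
    where open ℕ.≤-Reasoning

  quota-sum : ∀ f → 1 ≤ f → quota true f + quota false f ≡ 3 ℕ.* f + 1
  quota-sum (suc k) _ = begin
    quota true (suc k) + quota false (suc k)
      ≡⟨ solve 3 (λ k a b → con 2 :+ k :+ a :+ (con 2 :+ k :+ b) := con 4 :+ k :+ k :+ (a :+ b)) refl
           k (half true (suc k)) (half false (suc k)) ⟩
    4 + k + k + (half true (suc k) + half false (suc k))   ≡⟨ cong (4 + k + k +_) (half-not true (suc k)) ⟩
    4 + k + k + k                                         ≡⟨ solve 1 (λ k → con 4 :+ k :+ k :+ k := con 3 :* (con 1 :+ k) :+ con 1) refl k ⟩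
    3 ℕ.* suc k + 1                                       ∎
    where
    open ≡-Reasoning
    open Data.Nat.Solver.+-*-Solver

  -- The inequality for which the quotas are tuned. `g` and `j` are the budgets of undetected faults
  -- before and just after a visit on side `b`; the visitors and the robots then recalled from the
  -- other side outnumber `g + g`. The bound on `j` amounts to `j ≤ pred g - half b g`, whence
  -- `j + half (not b) j ≤ pred g`, which is the sum of the two halves of `g`.
  quota-call : ∀ b {g j} → j ≤ (g + g) ∸ quota b g →
               suc (g + g + quota (not b) j) ≤ quota b g + quota (not b) g
  quota-call b {g} {j} j≤ = begin
    suc (g + g + quota (not b) j)
      ≡⟨ solve 3 (λ g j h → con 1 :+ (g :+ g :+ (con 1 :+ (j :+ h))) := con 2 :+ (g :+ g) :+ (j :+ h))
           refl g j (half (not b) j) ⟩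
    2 + (g + g) + (j + half (not b) j)
      ≤⟨ ℕ.+-monoʳ-≤ (2 + (g + g)) (ℕ.+-mono-≤ j≤′ (half-not≤half b (ℕ.≤-trans j≤′ (ℕ.m∸n≤m _ (half b g))))) ⟩
    2 + (g + g) + (pred g ∸ half b g + half b g)
      ≡⟨ cong (2 + (g + g) +_) (trans (ℕ.m∸n+n≡m half≤pred) (sym (half-not b g))) ⟩
    2 + (g + g) + (half b g + half (not b) g)
      ≡⟨ solve 3 (λ g a b → con 2 :+ (g :+ g) :+ (a :+ b) := con 1 :+ (g :+ a) :+ (con 1 :+ (g :+ b)))
           refl g (half b g) (half (not b) g) ⟩
    quota b g + quota (not b) g   ∎
    where
    open ℕ.≤-Reasoning
    open Data.Nat.Solver.+-*-Solver using (solve; con; _:+_; _:=_)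
    half≤pred : half b g ≤ pred g
    half≤pred = subst (half b g ≤_) (half-not b g) (ℕ.m≤m+n _ _)
    j≤′ : j ≤ pred g ∸ half b g
    j≤′ = subst (j ≤_) eq j≤
      where
      ∸-suc : ∀ m n → m ∸ suc n ≡ pred m ∸ n
      ∸-suc zero    n = sym (ℕ.0∸n≡0 n)
      ∸-suc (suc m) n = refl
      eq : (g + g) ∸ quota b g ≡ pred g ∸ half b g
      eq = trans (cong ((g + g) ∸_) (sym (ℕ.+-suc g (half b g))))
             (trans (ℕ.[m+n]∸[m+o]≡n∸o g g (suc (half b g))) (∸-suc g (half b g)))

  -- `d` and `d′` count the flags before and after the visit. The first inequality gives the bound
  -- on `f ∸ d′` required by `quota-call`; the second turns the fall of the opposite quota into
  -- released robots. The conclusion breaks the joint fault budget of two scenarios.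
  budget-exceeded : ∀ b f d d′ released → d ≤ f →
    d + (d + quota b (f ∸ d)) ≤ f + d′ →
    quota (not b) (f ∸ d) ≤ released + quota (not b) (f ∸ d′) →
    f + f ℕ.< d + (d + (quota b (f ∸ d) + released))
  budget-exceeded b f d d′ released d≤f flagged≤ released≥ = begin-strict
    f + f                                          ≡⟨ cong₂ _+_ f≡ f≡ ⟩
    (d + g) + (d + g)                              ≡⟨ solve 2 (λ d g → (d :+ g) :+ (d :+ g) := d :+ (d :+ (g :+ g))) refl d g ⟩
    d + (d + (g + g))                              <⟨ ℕ.+-monoʳ-< d (ℕ.+-monoʳ-< d enough) ⟩
    d + (d + (quota b g + released))               ∎
    where
    open ℕ.≤-Reasoning
    open Data.Nat.Solver.+-*-Solver using (solve; con; _:+_; _:=_)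
    g = f ∸ d
    f≡ : f ≡ d + g
    f≡ = sym (ℕ.m+[n∸m]≡n d≤f)
    j = f ∸ d′
    j≤ : j ≤ (g + g) ∸ quota b g
    j≤ with ℕ.≤-total f d′
    -- Reliable visitors are flagged too, so `d′` may exceed `f`; the subtraction is then truncated
    -- to zero.
    ... | inj₁ f≤d′ = subst (_≤ (g + g) ∸ quota b g) (sym (ℕ.m≤n⇒m∸n≡0 f≤d′)) z≤n
    ... | inj₂ d′≤f = ℕ.m+n≤o⇒m≤o∸n j (ℕ.+-cancelˡ-≤ (d + d + d′) _ _ (begin
      d + d + d′ + (j + quota b g)         ≡⟨ solve 4 (λ d d′ j q → d :+ d :+ d′ :+ (j :+ q) := (d :+ (d :+ q)) :+ (d′ :+ j)) refl d d′ j (quota b g) ⟩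
      d + (d + quota b g) + (d′ + j)       ≤⟨ ℕ.+-monoˡ-≤ (d′ + j) flagged≤ ⟩
      f + d′ + (d′ + j)                    ≡⟨ cong (f + d′ +_) (ℕ.m+[n∸m]≡n d′≤f) ⟩
      f + d′ + f                           ≡⟨ cong (λ f → f + d′ + f) f≡ ⟩
      (d + g) + d′ + (d + g)               ≡⟨ solve 3 (λ d d′ g → (d :+ g) :+ d′ :+ (d :+ g) := d :+ d :+ d′ :+ (g :+ g)) refl d d′ g ⟩
      d + d + d′ + (g + g)                 ∎))
    enough : g + g ℕ.< quota b g + released
    enough = ℕ.+-cancelʳ-< (quota (not b) j) _ _ (begin-strict
      g + g + quota (not b) j               <⟨ quota-call b j≤ ⟩
      quota b g + quota (not b) g           ≤⟨ ℕ.+-monoʳ-≤ (quota b g) released≥ ⟩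
      quota b g + (released + quota (not b) j)  ≡⟨ ℕ.+-assoc (quota b g) released _ ⟨
      quota b g + released + quota (not b) j    ∎)

-- Linear arithmetic, infima of times, and rays.

module Reals (em : ExcludedMiddle 0ℓ) (real : CompleteOrderedField) where

  open LineSearch real public using (ℝ; 0#; _<_)
  open CompleteOrderedField real public using (_≤_; _+_; _-_; -_)
  open CompleteOrderedField real
    using (1#; _*_; isCommutativeRing; 0≢1; inverse; isTotalOrder; +-monoʳ-≤; *-nonNeg; supremum)

  ring : CommutativeRing 0ℓ 0ℓ
  ring = record { isCommutativeRing = isCommutativeRing }

  open CommutativeRing ring
    using (+-comm; +-assoc; +-identityˡ; +-identityʳ; -‿inverseˡ; -‿inverseʳ;
           *-identityˡ; *-identityʳ; distribˡ; distribʳ)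
  open Algebra.Properties.Group (CommutativeRing.+-group ring) using (∙-cancelʳ)
  open Algebra.Properties.CommutativeSemigroup
    (CommutativeMonoid.commutativeSemigroup (CommutativeRing.+-commutativeMonoid ring)) using (interchange)
  open Algebra.Properties.Monoid.Mult (CommutativeRing.+-monoid ring)
    renaming (_×_ to _·_) using (×-homo-+)
  open Algebra.Properties.Ring (CommutativeRing.ring ring) using (-‿distribʳ-*; -‿involutive)
  open IsTotalOrder isTotalOrder public
    using (total) renaming (refl to ≤-refl; reflexive to ≤-reflexive; trans to ≤-trans; antisym to ≤-antisym)

  ≰⇒> : ∀ {x y} → ¬ x ≤ y → y < x
  ≰⇒> {x} {y} x≰y with total x y
  ... | inj₁ x≤y = contradiction x≤y x≰y
  ... | inj₂ y≤x = y≤x , λ { refl → x≰y ≤-refl }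

  <⇒≱ : ∀ {x y} → x < y → ¬ y ≤ x
  <⇒≱ (x≤y , x≢y) y≤x = x≢y (≤-antisym x≤y y≤x)

  <-≤-trans : ∀ {x y z} → x < y → y ≤ z → x < z
  <-≤-trans x<y y≤z = ≰⇒> λ z≤x → <⇒≱ x<y (≤-trans y≤z z≤x)

  ≤-<-trans : ∀ {x y z} → x ≤ y → y < z → x < z
  ≤-<-trans x≤y y<z = ≰⇒> λ z≤x → <⇒≱ y<z (≤-trans z≤x x≤y)

  ≤⊎> : ∀ x y → x ≤ y ⊎ y < x
  ≤⊎> x y with em {x ≤ y}
  ... | yes x≤y = inj₁ x≤y
  ... | no  x≰y = inj₂ (≰⇒> x≰y)

  +-mono-≤ : ∀ {u v x y} → u ≤ v → x ≤ y → u + x ≤ v + y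
  +-mono-≤ {u} {v} {x} {y} u≤v x≤y =
    ≤-trans (+-monoʳ-≤ u x≤y) (subst₂ _≤_ (+-comm y u) (+-comm y v) (+-monoʳ-≤ y u≤v))

  +-cancelʳ-≤ : ∀ {x y} z → x + z ≤ y + z → x ≤ y
  +-cancelʳ-≤ z le = subst₂ _≤_ (cancel _) (cancel _) (+-mono-≤ le (≤-refl { - z}))
    where
    cancel : ∀ w → w + z + - z ≡ w
    cancel w = trans (+-assoc w z (- z)) (trans (cong (w +_) (-‿inverseʳ z)) (+-identityʳ w))

  module Linear where

    infixl 6 _⊕_
    infix  8 ⊝_
    infix  4 _≲_
    infixr 3 _⇒_

    data Expr (n : ℕ) : Set where
      var : Fin n → Expr n
      O   : Expr n
      _⊕_ : Expr n → Expr n → Expr n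
      ⊝_  : Expr n → Expr n

    data Sequent (n : ℕ) : Set where
      _≲_ : Expr n → Expr n → Sequent n
      _⇒_ : Expr n × Expr n → Sequent n → Sequent n

    ⟦_⟧ : ∀ {n} → Expr n → Vec ℝ n → ℝ
    ⟦ var i ⟧ ρ = lookup ρ i
    ⟦ O     ⟧ ρ = 0#
    ⟦ d ⊕ e ⟧ ρ = ⟦ d ⟧ ρ + ⟦ e ⟧ ρ
    ⟦ ⊝ e   ⟧ ρ = - ⟦ e ⟧ ρ

    Holds : ∀ {n} → Sequent n → Vec ℝ n → Set
    Holds (d ≲ e)       ρ = ⟦ d ⟧ ρ ≤ ⟦ e ⟧ ρ
    Holds ((d , e) ⇒ φ) ρ = ⟦ d ⟧ ρ ≤ ⟦ e ⟧ ρ → Holds φ ρ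

    unit : ∀ {n} → Fin n → Vec ℕ n
    unit zero    = 1 ∷ replicate _ 0
    unit (suc i) = 0 ∷ unit i

    -- Coefficients are recorded as two vectors of natural numbers, for positive and negative
    -- occurrences. Comparing normal forms then computes and is closed by `refl`, although the field
    -- is abstract.
    pos neg : ∀ {n} → Expr n → Vec ℕ n
    pos (var i) = unit i
    pos O       = replicate _ 0
    pos (d ⊕ e) = zipWith ℕ._+_ (pos d) (pos e)
    pos (⊝ e)   = neg e
    neg (var i) = replicate _ 0
    neg O       = replicate _ 0
    neg (d ⊕ e) = zipWith ℕ._+_ (neg d) (neg e)
    neg (⊝ e)   = pos e

    combine : ∀ {n} → Vec ℕ n → Vec ℝ n → ℝ
    combine []       []      = 0#
    combine (k ∷ ks) (x ∷ ρ) = k · x + combine ks ρ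

    combine-0 : ∀ {n} (ρ : Vec ℝ n) → combine (replicate n 0) ρ ≡ 0#
    combine-0 []      = refl
    combine-0 (x ∷ ρ) = trans (+-identityˡ _) (combine-0 ρ)

    combine-unit : ∀ {n} (i : Fin n) ρ → combine (unit i) ρ ≡ lookup ρ i
    combine-unit zero    (x ∷ ρ) =
      trans (cong (x + 0# +_) (combine-0 ρ)) (trans (+-identityʳ _) (+-identityʳ x))
    combine-unit (suc i) (x ∷ ρ) = trans (+-identityˡ _) (combine-unit i ρ)

    combine-+ : ∀ {n} (ks ls : Vec ℕ n) ρ →
                combine (zipWith ℕ._+_ ks ls) ρ ≡ combine ks ρ + combine ls ρ
    combine-+ []       []       []      = sym (+-identityʳ 0#)
    combine-+ (k ∷ ks) (l ∷ ls) (x ∷ ρ) =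
      trans (cong₂ _+_ (×-homo-+ x k l) (combine-+ ks ls ρ)) (interchange (k · x) (l · x) _ _)

    normal : ∀ {n} (e : Expr n) ρ → ⟦ e ⟧ ρ + combine (neg e) ρ ≡ combine (pos e) ρ
    normal (var i) ρ = trans (cong (lookup ρ i +_) (combine-0 ρ))
                         (trans (+-identityʳ _) (sym (combine-unit i ρ)))
    normal O       ρ = +-identityˡ _
    normal (d ⊕ e) ρ = begin
      ⟦ d ⟧ ρ + ⟦ e ⟧ ρ + combine (zipWith ℕ._+_ (neg d) (neg e)) ρ
        ≡⟨ cong (⟦ d ⟧ ρ + ⟦ e ⟧ ρ +_) (combine-+ (neg d) (neg e) ρ) ⟩
      ⟦ d ⟧ ρ + ⟦ e ⟧ ρ + (combine (neg d) ρ + combine (neg e) ρ)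
        ≡⟨ interchange (⟦ d ⟧ ρ) (⟦ e ⟧ ρ) _ _ ⟩
      ⟦ d ⟧ ρ + combine (neg d) ρ + (⟦ e ⟧ ρ + combine (neg e) ρ)
        ≡⟨ cong₂ _+_ (normal d ρ) (normal e ρ) ⟩
      combine (pos d) ρ + combine (pos e) ρ
        ≡⟨ combine-+ (pos d) (pos e) ρ ⟨
      combine (zipWith ℕ._+_ (pos d) (pos e)) ρ ∎
      where open ≡-Reasoning
    normal (⊝ e)   ρ = begin
      - x + combine (pos e) ρ            ≡⟨ cong (- x +_) (normal e ρ) ⟨
      - x + (x + combine (neg e) ρ)      ≡⟨ +-assoc (- x) x _ ⟨
      - x + x + combine (neg e) ρ        ≡⟨ cong (_+ combine (neg e) ρ) (-‿inverseˡ x) ⟩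
      0# + combine (neg e) ρ             ≡⟨ +-identityˡ _ ⟩
      combine (neg e) ρ                  ∎
      where
      open ≡-Reasoning
      x = ⟦ e ⟧ ρ

    SameNormal : ∀ {n} → Expr n → Expr n → Set
    SameNormal d e = zipWith ℕ._+_ (pos d) (neg e) ≡ zipWith ℕ._+_ (pos e) (neg d)

    sound : ∀ {n} {d e : Expr n} ρ → SameNormal d e → ⟦ d ⟧ ρ ≡ ⟦ e ⟧ ρ
    sound {d = d} {e} ρ same = ∙-cancelʳ (combine (neg d) ρ + combine (neg e) ρ) _ _ (begin
      ⟦ d ⟧ ρ + (combine (neg d) ρ + combine (neg e) ρ)   ≡⟨ +-assoc (⟦ d ⟧ ρ) _ _ ⟨
      ⟦ d ⟧ ρ + combine (neg d) ρ + combine (neg e) ρ     ≡⟨ cong (_+ combine (neg e) ρ) (normal d ρ) ⟩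
      combine (pos d) ρ + combine (neg e) ρ               ≡⟨ combine-+ (pos d) (neg e) ρ ⟨
      combine (zipWith ℕ._+_ (pos d) (neg e)) ρ           ≡⟨ cong (λ ks → combine ks ρ) same ⟩
      combine (zipWith ℕ._+_ (pos e) (neg d)) ρ           ≡⟨ combine-+ (pos e) (neg d) ρ ⟩
      combine (pos e) ρ + combine (neg d) ρ               ≡⟨ cong (_+ combine (neg d) ρ) (normal e ρ) ⟨
      ⟦ e ⟧ ρ + combine (neg e) ρ + combine (neg d) ρ     ≡⟨ +-assoc (⟦ e ⟧ ρ) _ _ ⟩
      ⟦ e ⟧ ρ + (combine (neg e) ρ + combine (neg d) ρ)   ≡⟨ cong (⟦ e ⟧ ρ +_) (+-comm (combine (neg e) ρ) _) ⟩
      ⟦ e ⟧ ρ + (combine (neg d) ρ + combine (neg e) ρ)   ∎)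
      where open ≡-Reasoning

    -- The conclusion is the sum of the hypotheses (accumulated as a ≲ b), up to
    -- adding the same term to both sides.
    SumOfHyps : ∀ {n} → Expr n → Expr n → Sequent n → Set
    SumOfHyps a b (d ≲ e)       = SameNormal (d ⊕ b) (e ⊕ a)
    SumOfHyps a b ((d , e) ⇒ φ) = SumOfHyps (a ⊕ d) (b ⊕ e) φ

    entails : ∀ {n} (ρ : Vec ℝ n) a b φ → SumOfHyps a b φ → ⟦ a ⟧ ρ ≤ ⟦ b ⟧ ρ → Holds φ ρ
    entails ρ a b (d ≲ e) same a≤b =
      +-cancelʳ-≤ (⟦ b ⟧ ρ) (subst (_≤ ⟦ e ⟧ ρ + ⟦ b ⟧ ρ)
        (sym (sound {d = d ⊕ b} {e = e ⊕ a} ρ same)) (+-monoʳ-≤ (⟦ e ⟧ ρ) a≤b))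
    entails ρ a b ((d , e) ⇒ φ) same a≤b d≤e = entails ρ (a ⊕ d) (b ⊕ e) φ same (+-mono-≤ a≤b d≤e)

    close : ∀ {A : Set} n → N-ary n (Expr n) A → A
    close n f = f $ⁿ Vec.map var (allFin n)

    -- Every hypothesis enters with coefficient one, so one that is needed several times is listed
    -- several times.
    linear : ∀ {n} (ρ : Vec ℝ n) (f : N-ary n (Expr n) (Sequent n)) →
             SumOfHyps O O (close n f) → Holds (close n f) ρ
    linear {n} ρ f same = entails ρ O O (close n f) same ≤-refl

    solve : ∀ {n} (ρ : Vec ℝ n) (f : N-ary n (Expr n) (Expr n × Expr n)) → let d , e = close n f in
            SameNormal d e → ⟦ d ⟧ ρ ≡ ⟦ e ⟧ ρ
    solve {n} ρ f same = sound {d = proj₁ (close n f)} {e = proj₂ (close n f)} ρ same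

  open Linear public using (_⊕_; ⊝_; O; _≲_; _⇒_; linear; solve)

  0≤1 : 0# ≤ 1#
  0≤1 with total 0# 1#
  ... | inj₁ 0≤1 = 0≤1
  ... | inj₂ 1≤0 = subst (0# ≤_) -1*-1≡1 (*-nonNeg 0≤-1 0≤-1)
    where
    0≤-1 : 0# ≤ - 1#
    0≤-1 = linear (1# ∷ []) (λ x → (x , O) ⇒ O ≲ ⊝ x) refl 1≤0
    -1*-1≡1 : - 1# * - 1# ≡ 1#
    -1*-1≡1 = trans (sym (-‿distribʳ-* (- 1#) 1#))
                (trans (cong -_ (*-identityʳ (- 1#))) (-‿involutive 1#))

  halve : ∀ x → ∃[ h ] h + h ≡ x
  halve x = x * ½ , (begin
    x * ½ + x * ½         ≡⟨ distribˡ x ½ ½ ⟨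
    x * (½ + ½)           ≡⟨ cong (λ z → x * (z + z)) (*-identityˡ ½) ⟨
    x * (1# * ½ + 1# * ½) ≡⟨ cong (x *_) (distribʳ ½ 1# 1#) ⟨
    x * ((1# + 1#) * ½)   ≡⟨ cong (x *_) (proj₂ (inverse (1# + 1#) 2≢0)) ⟩
    x * 1#                ≡⟨ *-identityʳ x ⟩
    x                     ∎)
    where
    open ≡-Reasoning
    2≢0 : 1# + 1# ≢ 0#
    2≢0 2≡0 = 0≢1 (≤-antisym 0≤1
      (linear (1# ∷ []) (λ i → (i ⊕ i , O) ⇒ (O , i) ⇒ i ≲ O) refl (≤-reflexive 2≡0) 0≤1))
    ½ = proj₁ (inverse (1# + 1#) 2≢0)

  module _ (P : ℝ → Set) (T : ℝ) where

    private
      -- The infimum is obtained as the supremum of these lower bounds; the cap `T` bounds them even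
      -- if `P` never holds.
      Early : ℝ → Set
      Early l = l ≤ T × (∀ {u} → 0# ≤ u → u ≤ T → P u → l ≤ u)

      early : ∃ Early
      early with total 0# T
      ... | inj₁ 0≤T = 0# , 0≤T , λ 0≤u _ _ → 0≤u
      ... | inj₂ T≤0 = T , ≤-refl , λ 0≤u _ _ → ≤-trans T≤0 0≤u

      supremum-early = supremum Early early (T , λ _ → proj₁)

    -- The infimum of T and of the times in [0, T] at which P holds.
    firstTime : ℝ
    firstTime = proj₁ supremum-early

    firstTime-greatest : ∀ {l} → l ≤ T → (∀ {u} → 0# ≤ u → u ≤ T → P u → l ≤ u) → l ≤ firstTime
    firstTime-greatest l≤T lower = proj₁ (proj₂ supremum-early) _ (l≤T , lower)

    firstTime≤ : firstTime ≤ T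
    firstTime≤ = proj₂ (proj₂ supremum-early) T λ _ → proj₁

    firstTime-lower : ∀ {u} → 0# ≤ u → u ≤ T → P u → firstTime ≤ u
    firstTime-lower 0≤u u≤T Pu = proj₂ (proj₂ supremum-early) _ λ l early-l → proj₂ early-l 0≤u u≤T Pu

    0≤firstTime : 0# ≤ T → 0# ≤ firstTime
    0≤firstTime 0≤T = firstTime-greatest 0≤T λ 0≤u _ _ → 0≤u

    firstTime-approx : ∀ {v} → v ≤ T → firstTime < v → ∃[ u ] 0# ≤ u × u < v × P u
    firstTime-approx {v} v≤T ft<v with em {∃[ u ] 0# ≤ u × u < v × P u}
    ... | yes found = found
    ... | no none = contradiction
      (firstTime-greatest v≤T λ {u} 0≤u _ Pu → [ (λ v≤u → v≤u) , (λ u<v → contradiction (u , 0≤u , u<v , Pu) none) ]′ (≤⊎> v u))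
      (<⇒≱ ft<v)

  -- The time `T` itself changes nothing, being the cap. So `P` and `Q` are compared strictly before
  -- `T` only, which makes turns depend on the strict past.
  firstTime-mono : ∀ {P Q : ℝ → Set} {T} → (∀ {u} → 0# ≤ u → u < T → P u → Q u) →
                   firstTime Q T ≤ firstTime P T
  firstTime-mono {P} {Q} {T} P⇒Q = firstTime-greatest P T (firstTime≤ Q T) below
    where
    below : ∀ {u} → 0# ≤ u → u ≤ T → P u → firstTime Q T ≤ u
    below {u} 0≤u u≤T Pu with ≤⊎> T u
    ... | inj₁ T≤u = ≤-trans (firstTime≤ Q T) T≤u
    ... | inj₂ u<T = firstTime-lower Q T 0≤u u≤T (P⇒Q 0≤u u<T Pu)

  firstTime-increasing : ∀ P {s t} → s ≤ t → firstTime P s ≤ firstTime P t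
  firstTime-increasing P {s} {t} s≤t = firstTime-greatest P t (≤-trans (firstTime≤ P s) s≤t) below
    where
    below : ∀ {u} → 0# ≤ u → u ≤ t → P u → firstTime P s ≤ u
    below {u} 0≤u _ Pu with total u s
    ... | inj₁ u≤s = firstTime-lower P s 0≤u u≤s Pu
    ... | inj₂ s≤u = ≤-trans (firstTime≤ P s) s≤u

  -- Lowering the cap by `t - s` lowers the infimum by at most as much. Together with
  -- `firstTime-increasing` this keeps `turn + turn - t` within unit speed.
  firstTime-lipschitz : ∀ P {s t} → s ≤ t → firstTime P t - firstTime P s ≤ t - s
  firstTime-lipschitz P {s} {t} s≤t =
    linear (c ∷ firstTime P s ∷ s ∷ t ∷ []) (λ c c′ s t → (c ⊕ ⊝ (t ⊕ ⊝ s) , c′) ⇒ c ⊕ ⊝ c′ ≲ t ⊕ ⊝ s) refl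
      (firstTime-greatest P s
        (linear (c ∷ s ∷ t ∷ []) (λ c s t → (c , t) ⇒ c ⊕ ⊝ (t ⊕ ⊝ s) ≲ s) refl (firstTime≤ P t))
        λ {u} 0≤u u≤s Pu →
          linear (c ∷ s ∷ t ∷ u ∷ []) (λ c s t u → (c , u) ⇒ (s , t) ⇒ c ⊕ ⊝ (t ⊕ ⊝ s) ≲ u) refl
            (firstTime-lower P t 0≤u (≤-trans u≤s s≤t) Pu) s≤t)
    where c = firstTime P t

  ray : Bool → ℝ → ℝ
  ray true  t = t
  ray false t = - t

  ray-neg : ∀ b t → ray b (- t) ≡ ray (not b) t
  ray-neg true  t = refl
  ray-neg false t = -‿involutive t

  -- Opposite rays meet only at the origin, so a point determines the time at which a full-speed
  -- walker can be there.
  ray-time : ∀ b c {s t} → 0# ≤ s → 0# ≤ t → ray b s ≡ ray c t → s ≡ t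
  ray-time true  true          _   _   s≡t = s≡t
  ray-time false false {s} {t} _   _   -s≡-t = trans (sym (-‿involutive s)) (trans (cong -_ -s≡-t) (-‿involutive t))
  ray-time true  false {s} {t} 0≤s 0≤t s≡-t = ≤-antisym
    (linear (s ∷ t ∷ []) (λ s t → (s , ⊝ t) ⇒ (O , t) ⇒ (O , t) ⇒ s ≲ t) refl (≤-reflexive s≡-t) 0≤t 0≤t)
    (linear (s ∷ t ∷ []) (λ s t → (s , ⊝ t) ⇒ (O , s) ⇒ (O , s) ⇒ t ≲ s) refl (≤-reflexive s≡-t) 0≤s 0≤s)
  ray-time false true  {s} {t} 0≤s 0≤t -s≡t = ≤-antisym
    (linear (s ∷ t ∷ []) (λ s t → (t , ⊝ s) ⇒ (O , t) ⇒ (O , t) ⇒ s ≲ t) refl (≤-reflexive (sym -s≡t)) 0≤t 0≤t)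
    (linear (s ∷ t ∷ []) (λ s t → (t , ⊝ s) ⇒ (O , s) ⇒ (O , s) ⇒ t ≲ s) refl (≤-reflexive (sym -s≡t)) 0≤s 0≤s)

  ray-surjective : ∀ x → ∃[ b ] ∃[ s ] 0# ≤ s × x ≡ ray b s
  ray-surjective x with total 0# x
  ... | inj₁ 0≤x = true , x , 0≤x , refl
  ... | inj₂ x≤0 = false , - x , linear (x ∷ []) (λ x → (x , O) ⇒ O ≲ ⊝ x) refl x≤0 , sym (-‿involutive x)

  ray-0 : ∀ b → ray b 0# ≡ 0#
  ray-0 true  = refl
  ray-0 false = solve [] (⊝ O , O) refl

  ray-speed : ∀ b {x y d} → x - y ≤ d → y - x ≤ d → ray b x - ray b y ≤ d × ray b y - ray b x ≤ d
  ray-speed true              x-y≤d y-x≤d = x-y≤d , y-x≤d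
  ray-speed false {x} {y} {d} x-y≤d y-x≤d =
    linear (x ∷ y ∷ d ∷ []) (λ x y d → (y ⊕ ⊝ x , d) ⇒ ⊝ x ⊕ ⊝ (⊝ y) ≲ d) refl y-x≤d ,
    linear (x ∷ y ∷ d ∷ []) (λ x y d → (x ⊕ ⊝ y , d) ⇒ ⊝ y ⊕ ⊝ (⊝ x) ≲ d) refl x-y≤d

-- Robots of team true walk right, those of team false walk left.
module Teams {n f : ℕ} (quotas : quota true f ℕ.+ quota false f ≡ n) where

  team : Bool → Subset n
  team true  = first (quota true f) (full {n})
  team false = ∁ (team true)

  side : Fin n → Bool
  side r = lookup (team true) r

  team-side : ∀ b {r} → r ∈ team b → side r ≡ b
  team-side true  r∈ = []=⇒lookup r∈
  team-side false {r} r∈ with side r in eq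
  ... | false = refl
  ... | true  = contradiction (lookup⇒[]= r (team true) eq) (x∈∁p⇒x∉p r∈)

  ∣team∣ : ∀ b → ∣ team b ∣ ≡ quota b f
  ∣team∣ true = ∣first∣ (quota true f) (full {n}) (begin
    quota true f                    ≤⟨ ℕ.m≤m+n _ _ ⟩
    quota true f ℕ.+ quota false f  ≡⟨ quotas ⟩
    n                               ≡⟨ ∣⊤∣≡n n ⟨
    ∣ full {n} ∣                    ∎)
    where open ℕ.≤-Reasoning
  ∣team∣ false = begin
    ∣ ∁ (team true) ∣                              ≡⟨ ∣∁p∣≡n∸∣p∣ (team true) ⟩
    n ∸ ∣ team true ∣                              ≡⟨ cong₂ _∸_ (sym (quotas)) (∣team∣ true) ⟩
    quota true f ℕ.+ quota false f ∸ quota true f  ≡⟨ ℕ.m+n∸m≡n (quota true f) _ ⟩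
    quota false f                                  ∎
    where open ≡-Reasoning

  -- The robots of team b still on their ray once those in D have announced something.
  retained : Bool → Subset n → Subset n
  retained b D = first (quota b (f ∸ ∣ D ∣)) (team b ─ D)

  retained⊆team : ∀ b D → retained b D ⊆ team b
  retained⊆team b D = p─q⊆p (team b) D ∘ first⊆ (quota b (f ∸ ∣ D ∣)) (team b ─ D)

  retained-disjoint : ∀ b D {r} → r ∈ retained b D → r ∉ D
  retained-disjoint b D = x∈p─q⇒x∉q (team b) D ∘ first⊆ (quota b (f ∸ ∣ D ∣)) (team b ─ D)

  ∣retained∣≤ : ∀ b D → ∣ retained b D ∣ ℕ.≤ quota b (f ∸ ∣ D ∣)
  ∣retained∣≤ b D = ∣first∣≤ (quota b (f ∸ ∣ D ∣)) (team b ─ D)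

  ∣retained∣≥ : ∀ b D → ∣ D ∣ ℕ.≤ f → quota b (f ∸ ∣ D ∣) ℕ.≤ ∣ retained b D ∣
  ∣retained∣≥ b D ∣D∣≤f = ≤∣first∣ (quota b (f ∸ ∣ D ∣)) (team b ─ D) (ℕ.+-cancelʳ-≤ ∣ D ∣ _ _ (begin
    quota b (f ∸ ∣ D ∣) ℕ.+ ∣ D ∣   ≤⟨ quota-drop b ℕ.z≤n ∣D∣≤f ⟩
    quota b f ℕ.+ 0                 ≡⟨ ℕ.+-identityʳ _ ⟩
    quota b f                       ≡⟨ ∣team∣ b ⟨
    ∣ team b ∣                      ≤⟨ ∣p∣≤∣p─q∣+∣q∣ (team b) D ⟩
    ∣ team b ─ D ∣ ℕ.+ ∣ D ∣        ∎))
    where open ℕ.≤-Reasoning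

  -- A larger `D` moves the remaining team members up in the order, but by `quota-drop` the quota
  -- shrinks at least as much, as `first-mono` requires. With at most `f` robots flagged, recalls
  -- are therefore never revoked.
  retained-antitone : ∀ b {D D′} → D ⊆ D′ → ∣ D′ ∣ ℕ.≤ f → retained b D′ ⊆ retained b D
  retained-antitone b {D} {D′} D⊆D′ ∣D′∣≤f = first-mono (quota b (f ∸ ∣ D ∣)) (quota b (f ∸ ∣ D′ ∣)) (team b ─ D) (team b ─ D′) shrink
    (ℕ.+-cancelʳ-≤ (∣ D ∣ ℕ.+ ∣ D′ ∣) _ _ (begin
      ∣ team b ─ D ∣ ℕ.+ q′ ℕ.+ (∣ D ∣ ℕ.+ ∣ D′ ∣)
        ≡⟨ interchange (∣ team b ─ D ∣) q′ (∣ D ∣) (∣ D′ ∣) ⟩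
      ∣ team b ─ D ∣ ℕ.+ ∣ D ∣ ℕ.+ (q′ ℕ.+ ∣ D′ ∣)
        ≤⟨ ℕ.+-mono-≤ team≤ (quota-drop b (p⊆q⇒∣p∣≤∣q∣ D⊆D′) ∣D′∣≤f) ⟩
      ∣ team b ─ D′ ∣ ℕ.+ ∣ D′ ∣ ℕ.+ (q ℕ.+ ∣ D ∣)
        ≡⟨ interchange (∣ team b ─ D′ ∣) (∣ D′ ∣) q (∣ D ∣) ⟩
      ∣ team b ─ D′ ∣ ℕ.+ q ℕ.+ (∣ D′ ∣ ℕ.+ ∣ D ∣)
        ≡⟨ cong (∣ team b ─ D′ ∣ ℕ.+ q ℕ.+_) (ℕ.+-comm (∣ D′ ∣) (∣ D ∣)) ⟩
      ∣ team b ─ D′ ∣ ℕ.+ q ℕ.+ (∣ D ∣ ℕ.+ ∣ D′ ∣) ∎))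
    where
    open ℕ.≤-Reasoning
    open import Algebra.Properties.CommutativeSemigroup ℕ.+-commutativeSemigroup using (interchange)
    q  = quota b (f ∸ ∣ D ∣)
    q′ = quota b (f ∸ ∣ D′ ∣)
    shrink : team b ─ D′ ⊆ team b ─ D
    shrink r∈ = x∈p∧x∉q⇒x∈p─q (p─q⊆p (team b) D′ r∈) (x∈p─q⇒x∉q (team b) D′ r∈ ∘ D⊆D′)
    team∪⊆ : team b ∪ D ⊆ team b ∪ D′
    team∪⊆ r∈ = x∈p∪q⁺ ([ inj₁ , inj₂ ∘ D⊆D′ ]′ (x∈p∪q⁻ (team b) D r∈))
    team≤ : ∣ team b ─ D ∣ ℕ.+ ∣ D ∣ ℕ.≤ ∣ team b ─ D′ ∣ ℕ.+ ∣ D′ ∣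
    team≤ = subst₂ ℕ._≤_ (sym (∣p─q∣+∣q∣≡∣p∪q∣ (team b) D)) (sym (∣p─q∣+∣q∣≡∣p∪q∣ (team b) D′))
              (p⊆q⇒∣p∣≤∣q∣ team∪⊆)

module Collect (em : ExcludedMiddle 0ℓ) where

  collect : ∀ {n} → (Fin n → Set) → Subset n
  collect P = Vec.tabulate λ r → does (em {P r})

  ∈-collect⁺ : ∀ {n} {P : Fin n → Set} {r} → P r → r ∈ collect P
  ∈-collect⁺ {P = P} {r} Pr = lookup⇒[]= r _ (trans (lookup∘tabulate _ r) (dec-true em Pr))

  ∈-collect⁻ : ∀ {n} {P : Fin n → Set} {r} → r ∈ collect P → P r
  ∈-collect⁻ {P = P} {r} r∈ with em {P r} in eq
  ... | yes Pr = Pr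
  ... | no _ with () ← trans (sym ([]=⇒lookup r∈)) (trans (lookup∘tabulate _ r) (cong does eq))

  collect-mono : ∀ {n} {P Q : Fin n → Set} → (∀ r → P r → Q r) → collect P ⊆ collect Q
  collect-mono P⇒Q r∈ = ∈-collect⁺ (P⇒Q _ (∈-collect⁻ r∈))

-- What announcements reveal about the target and the faults.

module Scenarios (em : ExcludedMiddle 0ℓ) (real : CompleteOrderedField) where
  open Reals em real
  open LineSearch real using
    (Motion; IsMotion; History; AgreeUpTo; Strategy; broadcasts; Scenario; thrice)

  broadcast-inv : ∀ {n} (m : Fin n → Motion) a {r t p} → broadcasts m a r t ≡ just p → a r t ≡ true × m r t ≡ p
  broadcast-inv m a {r} {t} eq with a r t
  ... | true = refl , just-injective eq

  broadcast-true : ∀ {n} (m : Fin n → Motion) a {r t} → a r t ≡ true → broadcasts m a r t ≡ just (m r t)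
  broadcast-true m a {r} {t} eq = cong (λ b → if b then just (m r t) else nothing) eq

  thrice-mono : ∀ {s t} → s ≤ t → thrice s ≤ thrice t
  thrice-mono s≤t = +-mono-≤ (+-mono-≤ s≤t s≤t) s≤t

  ≤thrice : ∀ {s} → 0# ≤ s → s ≤ thrice s
  ≤thrice {s} 0≤s = linear (s ∷ []) (λ s → (O , s) ⇒ (O , s) ⇒ s ≲ s ⊕ s ⊕ s) refl 0≤s 0≤s

  0≤thrice : ∀ {s} → 0# ≤ s → 0# ≤ thrice s
  0≤thrice 0≤s = ≤-trans 0≤s (≤thrice 0≤s)

  module _ {n f} {σ : Strategy n} (S : Scenario σ f) where
    open Scenario S
    open Strategy σ using (trajectory)

    announcement-true : ∀ {r t p} → r ∉ faulty → 0# ≤ t → history r t ≡ just p → p ≡ target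
    announcement-true r∉ 0≤t eq with announced , at ← broadcast-inv motion announces eq =
      trans (sym at) (Equivalence.to (truthful r∉ 0≤t) announced)

    false-announcement : ∀ {r t p} → 0# ≤ t → history r t ≡ just p → p ≢ target → r ∈ faulty
    false-announcement {r} 0≤t eq p≢ with r ∈? faulty
    ... | yes r∈ = r∈
    ... | no  r∉ = contradiction (announcement-true r∉ 0≤t eq) p≢

    reliable-announces : ∀ {r t} → r ∉ faulty → 0# ≤ t → trajectory history r t ≡ target →
                         history r t ≡ just target
    reliable-announces {r} {t} r∉ 0≤t at-target =
      trans (broadcast-true motion announces (Equivalence.from (truthful r∉ 0≤t) at)) (cong just at)
      where
      at : motion r t ≡ target
      at = trans (follows r∉ 0≤t) at-target

-- Upper bound: the algorithm and its search time.

module Upper (em : ExcludedMiddle 0ℓ) (real : CompleteOrderedField)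
             {n f : ℕ} (quotas : quota true f ℕ.+ quota false f ≡ n) where
  open Reals em real
  open Collect em
  open Scenarios em real
  open Teams {f = f} quotas
  open LineSearch real hiding (0#; ℝ; _<_)

  -- Announcements made elsewhere than on the robot's own ray at full speed are ignored.
  Front : History n → Fin n → ℝ → Set
  Front h r u = h r u ≡ just (ray (side r) u)

  -- Both versions are needed: before the arrival at the target only faulty robots are flagged, at
  -- the arrival reliable visitors are flagged as well.
  flaggedBy flaggedBefore : History n → ℝ → Subset n
  flaggedBy     h t = collect λ r → ∃[ u ] 0# ≤ u × u ≤ t × Front h r u
  flaggedBefore h t = collect λ r → ∃[ u ] 0# ≤ u × u < t × Front h r u

  Recalled : History n → Fin n → ℝ → Set
  Recalled h r t = r ∉ retained (side r) (flaggedBy h t)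

  -- Until the robot is recalled this equals the current time `t`, afterwards it is constant, so a
  -- single formula in `trajectory` serves both legs.
  turn : History n → Fin n → ℝ → ℝ
  turn h r t = firstTime (Recalled h r) t

  -- Outward until the turn, then back.  The turn is an infimum, since in continuous time
  -- there need not be a first announcement.
  trajectory : History n → Fin n → Motion
  trajectory h r t = ray (side r) (turn h r t + turn h r t - t)

  SameFrontBefore : ℝ → History n → History n → Set
  SameFrontBefore t h h′ = ∀ r {u} → 0# ≤ u → u < t → Front h r u ⇔ Front h′ r u

  same-front-sym : ∀ {t h h′} → SameFrontBefore t h h′ → SameFrontBefore t h′ h
  same-front-sym same r 0≤u u<t = mk⇔ (Equivalence.from (same r 0≤u u<t)) (Equivalence.to (same r 0≤u u<t))

  flaggedBy-⊆ : ∀ {t h h′} → SameFrontBefore t h h′ → ∀ {u} → u < t → flaggedBy h u ⊆ flaggedBy h′ u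
  flaggedBy-⊆ same u<t = collect-mono λ r (v , 0≤v , v≤u , front) →
    v , 0≤v , v≤u , Equivalence.to (same r 0≤v (≤-<-trans v≤u u<t)) front

  turn-≤ : ∀ {t h h′} → SameFrontBefore t h h′ → ∀ r → turn h′ r t ≤ turn h r t
  turn-≤ {t} {h} {h′} same r = firstTime-mono λ _ u<t →
    subst (λ D → r ∉ retained (side r) D)
      (⊆-antisym (flaggedBy-⊆ same u<t) (flaggedBy-⊆ (same-front-sym {h = h} same) u<t))

  trajectory-cong : ∀ {t h h′} → SameFrontBefore t h h′ → ∀ r → trajectory h r t ≡ trajectory h′ r t
  trajectory-cong {t} {h} {h′} same r = cong (λ c → ray (side r) (c + c - t))
    (≤-antisym (turn-≤ (same-front-sym {h = h} same) r) (turn-≤ same r))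

  trajectory-isMotion : ∀ h r → IsMotion (trajectory h r)
  trajectory-isMotion h r = record
    { start   = trans (cong (ray (side r)) (trans (cong (λ c → c + c - 0#) turn-0) (solve [] (O ⊕ O ⊕ ⊝ O , O) refl)))
                      (ray-0 (side r))
    ; speed≤1 = λ {s} {t} 0≤s s≤t →
        let c  = turn h r s
            c′ = turn h r t
            c≤c′ = firstTime-increasing (Recalled h r) s≤t
            slow = firstTime-lipschitz (Recalled h r) s≤t
        in ray-speed (side r)
             (linear (c ∷ c′ ∷ s ∷ t ∷ []) (λ c c′ s t → (c′ ⊕ ⊝ c , t ⊕ ⊝ s) ⇒ (c′ ⊕ ⊝ c , t ⊕ ⊝ s) ⇒
                c′ ⊕ c′ ⊕ ⊝ t ⊕ ⊝ (c ⊕ c ⊕ ⊝ s) ≲ t ⊕ ⊝ s) refl slow slow)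
             (linear (c ∷ c′ ∷ s ∷ t ∷ []) (λ c c′ s t → (c , c′) ⇒ (c , c′) ⇒
                c ⊕ c ⊕ ⊝ s ⊕ ⊝ (c′ ⊕ c′ ⊕ ⊝ t) ≲ t ⊕ ⊝ s) refl c≤c′ c≤c′)
    }
    where
    turn-0 : turn h r 0# ≡ 0#
    turn-0 = ≤-antisym (firstTime≤ (Recalled h r) 0#) (0≤firstTime (Recalled h r) 0# ≤-refl)

  strategy : Strategy n
  strategy = record
    { trajectory = trajectory
    ; isMotion   = trajectory-isMotion
    ; causal     = λ {h} {h′} _ agree → trajectory-cong λ r 0≤u u<t →
        let same = agree r 0≤u (proj₁ u<t) in mk⇔ (trans (sym same)) (trans same)
    }

  stays : ∀ h r {t} → (∀ {u} → 0# ≤ u → u < t → ¬ Recalled h r u) → turn h r t ≡ t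
  stays h r {t} kept = ≤-antisym (firstTime≤ (Recalled h r) t)
    (firstTime-greatest (Recalled h r) t ≤-refl λ {u} 0≤u _ recalled →
      [ (λ t≤u → t≤u) , (λ u<t → contradiction recalled (kept 0≤u u<t)) ]′ (≤⊎> t u))

  on-ray : ∀ h r {t} → (∀ {u} → 0# ≤ u → u < t → ¬ Recalled h r u) → trajectory h r t ≡ ray (side r) t
  on-ray h r {t} kept = cong (ray (side r))
    (trans (cong (λ c → c + c - t) (stays h r kept)) (solve (t ∷ []) (λ t → (t ⊕ t ⊕ ⊝ t , t)) refl))

  -- With the turn at `s`, the position along the robot's own ray at time `thrice s` is
  -- `s + s - thrice s`, that is `- s`.
  comes-back : ∀ h r {s} → 0# ≤ s → (∀ {u} → 0# ≤ u → u < s → ¬ Recalled h r u) → Recalled h r s →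
               trajectory h r (thrice s) ≡ ray (not (side r)) s
  comes-back h r {s} 0≤s kept recalled = trans
    (cong (ray (side r)) (trans (cong (λ c → c + c - thrice s) turn≡s)
                                (solve (s ∷ []) (λ s → (s ⊕ s ⊕ ⊝ (s ⊕ s ⊕ s) , ⊝ s)) refl)))
    (ray-neg (side r) s)
    where
    turn≡s : turn h r (thrice s) ≡ s
    turn≡s = ≤-antisym (firstTime-lower (Recalled h r) (thrice s) 0≤s (≤thrice 0≤s) recalled)
      (subst (_≤ turn h r (thrice s)) (stays h r kept) (firstTime-increasing (Recalled h r) (≤thrice 0≤s)))

  retained-before : ∀ h b {s r} → ∣ flaggedBefore h s ∣ ℕ.≤ f → r ∈ retained b (flaggedBefore h s) →
                    ∀ {u} → 0# ≤ u → u < s → ¬ Recalled h r u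
  retained-before h b {s} {r} small r∈ {u} _ u<s recalled = recalled
    (subst (λ c → r ∈ retained c (flaggedBy h u)) (sym (team-side b (retained⊆team b _ r∈)))
      (retained-antitone b (collect-mono λ _ (v , 0≤v , v≤u , front) → v , 0≤v , ≤-<-trans v≤u u<s , front) small r∈))

  -- Trajectories depend on earlier front announcements only, and a reliable robot makes one
  -- only at the time |x|.  So two passes suffice: with the reliable robots silent, and then
  -- with the front announcements that they make on the trajectories of the first pass.
  wellPosed : WellPosed strategy f
  wellPosed x x≢0 F ∣F∣≤f m m-isMotion a = S , refl , refl , S-faulty
    where
    silent noticed : History n
    silent r t with r ∈? F
    ... | yes _ = broadcasts m a r t
    ... | no _  = nothing
    noticed r t with r ∈? F
    ... | yes _ = broadcasts m a r t
    ... | no _ with em {ray (side r) t ≡ x × trajectory silent r t ≡ x}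
    ...   | yes _ = just (ray (side r) t)
    ...   | no _  = nothing

    motion : Fin n → Motion
    motion r with r ∈? F
    ... | yes _ = m r
    ... | no _  = trajectory noticed r

    announces : Fin n → ℝ → Bool
    announces r t with r ∈? F
    ... | yes _ = a r t
    ... | no _  = does (em {trajectory noticed r t ≡ x})

    -- A reliable robot adds a front announcement only when its ray passes `x`, and `ray-time`
    -- allows just one such time, so the two passes agree before it.
    silent-noticed : ∀ {r₀ t} → 0# ≤ t → ray (side r₀) t ≡ x → SameFrontBefore t silent noticed
    silent-noticed {r₀} {t} 0≤t at-x r {u} 0≤u u<t with r ∈? F
    ... | yes _ = mk⇔ (λ e → e) (λ e → e)
    ... | no _ with em {ray (side r) u ≡ x × trajectory silent r u ≡ x}
    ...   | no _ = mk⇔ (λ e → e) (λ e → e)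
    ...   | yes (u-at-x , _) =
      contradiction (ray-time (side r) (side r₀) 0≤u 0≤t (trans u-at-x (sym at-x))) (proj₂ u<t)

    -- On its way back a reliable robot may announce `x` off its own ray; `noticed` omits this
    -- message, which is not a front announcement.
    noticed-history : ∀ {t} → SameFrontBefore t noticed (broadcasts motion announces)
    noticed-history r {u} 0≤u _ with r ∈? F
    ... | yes _ = mk⇔ (λ e → e) (λ e → e)
    ... | no _ with em {ray (side r) u ≡ x × trajectory silent r u ≡ x} | em {trajectory noticed r u ≡ x}
    ...   | no _  | no _ = mk⇔ (λ ()) (λ ())
    ...   | yes (at-x , traj) | yes traj′ = mk⇔ (λ _ → cong just (trans traj′ (sym at-x))) (λ _ → refl)
    ...   | no ¬front | yes traj′ = mk⇔ (λ ()) λ e →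
      let at-x = trans (sym (just-injective e)) traj′ in
      contradiction (at-x , trans (trajectory-cong (silent-noticed {r} 0≤u at-x) r) traj′) ¬front
    ...   | yes (at-x , traj) | no ¬traj′ =
      contradiction (trans (sym (trajectory-cong (silent-noticed {r} 0≤u at-x) r)) traj) ¬traj′

    S : Scenario strategy f
    S = record
      { target    = x
      ; target≢0  = x≢0
      ; faulty    = F
      ; ∣faulty∣≤f = ∣F∣≤f
      ; motion    = motion
      ; isMotion  = motion-isMotion
      ; announces = announces
      ; follows   = λ {r} {t} r∉ _ → trans (motion-reliable r∉ t) (trajectory-cong noticed-history r)
      ; truthful  = truthful
      }
      where
      motion-isMotion : ∀ r → IsMotion (motion r)
      motion-isMotion r with r ∈? F
      ... | yes _ = m-isMotion r
      ... | no _  = trajectory-isMotion noticed r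
      motion-reliable : ∀ {r} → r ∉ F → ∀ t → motion r t ≡ trajectory noticed r t
      motion-reliable {r} r∉ t with r ∈? F
      ... | yes r∈ = contradiction r∈ r∉
      ... | no _   = refl
      truthful : ∀ {r t} → r ∉ F → 0# ≤ t → announces r t ≡ true ⇔ motion r t ≡ x
      truthful {r} {t} r∉ _ with r ∈? F
      ... | yes r∈ = contradiction r∈ r∉
      ... | no _ with em {trajectory noticed r t ≡ x}
      ...   | yes at-x = mk⇔ (λ _ → at-x) (λ _ → refl)
      ...   | no ¬at-x = mk⇔ (λ ()) (λ at-x → contradiction at-x ¬at-x)

    S-faulty : ∀ {r t} → r ∈ F → 0# ≤ t → motion r t ≡ m r t × announces r t ≡ a r t
    S-faulty {r} r∈ _ with r ∈? F
    ... | yes _  = refl , refl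
    ... | no  r∉ = contradiction r∈ r∉

  algorithm : SearchAlgorithm n f
  algorithm = record { strategy = strategy ; wellPosed = wellPosed }

  open Scenario

  module FirstVisit (S : Scenario strategy f) (b : Bool) (s : ℝ) (0≤s : 0# ≤ s) (S-target : target S ≡ ray b s) where

    h : History n
    h = history S

    D : Subset n
    D = flaggedBefore h s

    -- A robot walking its ray at full speed can be at the target at time `s` only, so front
    -- announcements before `s` are false.
    D⊆faulty : D ⊆ faulty S
    D⊆faulty {r} r∈ with u , 0≤u , u<s , front ← ∈-collect⁻ r∈ = false-announcement S 0≤u front λ at-target →
      proj₂ u<s (ray-time (side r) b 0≤u 0≤s (trans at-target S-target))

    ∣D∣≤f : ∣ D ∣ ℕ.≤ f
    ∣D∣≤f = ℕ.≤-trans (p⊆q⇒∣p∣≤∣q∣ D⊆faulty) (∣faulty∣≤f S)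

    B : Subset n
    B = retained b D

    B-side : ∀ {r} → r ∈ B → side r ≡ b
    B-side r∈ = team-side b (retained⊆team b D r∈)

    B-announces : ∀ {r} → r ∈ B → r ∉ faulty S → h r s ≡ just (target S)
    B-announces {r} r∈ r∉ = reliable-announces S r∉ 0≤s
      (trans (on-ray h r (retained-before h b ∣D∣≤f r∈)) (trans (cong (λ c → ray c s) (B-side r∈)) (sym S-target)))

    -- `B` and `D` together have more than `f` members by `quota-∸`, so one of them is reliable, and
    -- it cannot be in `D`.
    reliable-visitor : ∃[ r ] r ∈ B × r ∉ faulty S
    reliable-visitor =
      let r , r∈ , r∉ = ∣q∣<∣p∣⇒p⊈q (B ∪ D) (faulty S) more in
      r , [ (λ r∈B → r∈B) , (λ r∈D → contradiction (D⊆faulty r∈D) r∉) ]′ (x∈p∪q⁻ B D r∈) , r∉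
      where
      open ℕ.≤-Reasoning
      more : ∣ faulty S ∣ ℕ.< ∣ B ∪ D ∣
      more = begin-strict
        ∣ faulty S ∣                         ≤⟨ ∣faulty∣≤f S ⟩
        f                                    <⟨ ℕ.s≤s (ℕ.m≤m+n f _) ⟩
        suc (f ℕ.+ half b (f ∸ ∣ D ∣))       ≡⟨ quota-∸ b ∣D∣≤f ⟨
        quota b (f ∸ ∣ D ∣) ℕ.+ ∣ D ∣        ≤⟨ ℕ.+-monoˡ-≤ ∣ D ∣ (∣retained∣≥ b D ∣D∣≤f) ⟩
        ∣ B ∣ ℕ.+ ∣ D ∣                      ≤⟨ disjoint⇒∣p∣+∣q∣≤∣p∪q∣ B D (retained-disjoint b D) ⟩
        ∣ B ∪ D ∣                            ∎

  module Indistinguishable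
    (S S′ : Scenario strategy f) (b b′ : Bool) (s s′ : ℝ)
    (0≤s : 0# ≤ s) (s≤s′ : s ≤ s′)
    (S-target : target S ≡ ray b s) (S′-target : target S′ ≡ ray b′ s′) (targets≢ : target S ≢ target S′)
    (agree : AgreeUpTo (thrice s) (history S) (history S′)) where

    open FirstVisit S b s 0≤s S-target

    -- `D′` adds to `D` the front announcements made at time `s`. `Released` collects the robots of
    -- the opposite team that these recall; if reliable, they are at the target of `S` at time
    -- `thrice s`.
    F F′ D′ Released : Subset n
    F  = faulty S
    F′ = faulty S′
    D′ = flaggedBy h s
    Released = retained (not b) D ─ retained (not b) D′

    -- Since `s ≤ s′`, front announcements before `s` precede the arrival at either target and are
    -- false in both scenarios.
    D⊆F′ : D ⊆ F′
    D⊆F′ {r} r∈ with u , 0≤u , u<s , front ← ∈-collect⁻ r∈ = false-announcement S′ 0≤u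
      (trans (sym (agree r 0≤u (≤-trans (proj₁ u<s) (≤thrice 0≤s)))) front) λ at-target →
      <⇒≱ (<-≤-trans u<s s≤s′) (≤-reflexive (sym (ray-time (side r) b′ 0≤u (≤-trans 0≤s s≤s′) (trans at-target S′-target))))

    announced⇒∈F′ : ∀ {r t} → 0# ≤ t → t ≤ thrice s → h r t ≡ just (target S) → r ∈ F′
    announced⇒∈F′ {r} 0≤t t≤ announced =
      false-announcement S′ 0≤t (trans (sym (agree r 0≤t t≤)) announced) targets≢

    B⊆F⊎F′ : ∀ {r} → r ∈ B → r ∈ F ⊎ r ∈ F′
    B⊆F⊎F′ {r} r∈ with r ∈? F
    ... | yes r∈F = inj₁ r∈F
    ... | no  r∉F = inj₂ (announced⇒∈F′ 0≤s (≤thrice 0≤s) (B-announces r∈ r∉F))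

    -- The purpose is a lower bound for `∣ D′ ∣`: a visitor escapes being flagged only by being
    -- faulty.
    B⊆F⊎D′ : ∀ {r} → r ∈ B → r ∈ F ⊎ r ∈ D′
    B⊆F⊎D′ {r} r∈ with r ∈? F
    ... | yes r∈F = inj₁ r∈F
    ... | no  r∉F = inj₂ (∈-collect⁺ (s , 0≤s , ≤-refl ,
      trans (B-announces r∈ r∉F) (cong just (trans S-target (cong (λ c → ray c s) (sym (B-side r∈)))))))

    -- The return takes place at time `thrice s`, still within the agreement. Silence there is a
    -- fault in `S`, an announcement one in `S′`.
    Released⊆F⊎F′ : ∀ {r} → r ∈ Released → r ∈ F ⊎ r ∈ F′
    Released⊆F⊎F′ {r} r∈ with r ∈? F
    ... | yes r∈F = inj₁ r∈F
    ... | no  r∉F = inj₂ (announced⇒∈F′ (0≤thrice 0≤s) ≤-refl (reliable-announces S r∉F (0≤thrice 0≤s)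
      (trans (comes-back h r 0≤s (retained-before h (not b) ∣D∣≤f r∈A) recalled)
             (trans (cong (λ c → ray c s) (trans (cong not r-side) (not-involutive b))) (sym S-target)))))
      where
      r∈A : r ∈ retained (not b) D
      r∈A = p─q⊆p (retained (not b) D) _ r∈
      r-side : side r ≡ not b
      r-side = team-side (not b) (retained⊆team (not b) D r∈A)
      recalled : Recalled h r s
      recalled = subst (λ c → r ∉ retained c D′) (sym r-side) (x∈p─q⇒x∉q (retained (not b) D) _ r∈)

    D⊆D′ : D ⊆ D′
    D⊆D′ = collect-mono λ _ (u , 0≤u , u<s , front) → u , 0≤u , proj₁ u<s , front

    B-Released-disjoint : ∀ {r} → r ∈ B → r ∉ Released
    B-Released-disjoint r∈B r∈R = not-¬ (B-side r∈B)
      (team-side (not b) (retained⊆team (not b) D (p─q⊆p (retained (not b) D) _ r∈R)))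

    -- `D` is faulty in both scenarios and counts twice; `B` and `Released`, disjoint from it and
    -- from each other, count once. `budget-exceeded` makes the total larger than `f + f`.
    absurd : ∀ {A : Set} → A
    absurd = contradiction 2f<2f (ℕ.<-irrefl refl)
      where
      open ℕ.≤-Reasoning
      B∪R⊆ : ∀ {r} → r ∈ B ∪ Released → r ∈ F ⊎ r ∈ F′
      B∪R⊆ r∈ = [ B⊆F⊎F′ , Released⊆F⊎F′ ]′ (x∈p∪q⁻ B Released r∈)
      D-disjoint : ∀ {r} → r ∈ D → r ∉ B ∪ Released
      D-disjoint r∈D r∈ = [ (λ r∈B → retained-disjoint b D r∈B r∈D)
                          , (λ r∈R → retained-disjoint (not b) D (p─q⊆p (retained (not b) D) _ r∈R) r∈D)
                          ]′ (x∈p∪q⁻ B Released r∈)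
      quota≤B : quota b (f ∸ ∣ D ∣) ℕ.≤ ∣ B ∣
      quota≤B = ∣retained∣≥ b D ∣D∣≤f
      -- The same double counting inside `S` alone, with `D′` in place of `F′`.
      flagged≤ : ∣ D ∣ ℕ.+ (∣ D ∣ ℕ.+ quota b (f ∸ ∣ D ∣)) ℕ.≤ f ℕ.+ ∣ D′ ∣
      flagged≤ = begin
        ∣ D ∣ ℕ.+ (∣ D ∣ ℕ.+ quota b (f ∸ ∣ D ∣))   ≤⟨ ℕ.+-monoʳ-≤ ∣ D ∣ (ℕ.+-monoʳ-≤ ∣ D ∣ quota≤B) ⟩
        ∣ D ∣ ℕ.+ (∣ D ∣ ℕ.+ ∣ B ∣)                 ≤⟨ count-twice D⊆faulty D⊆D′ B⊆F⊎D′ (λ r∈D r∈B → retained-disjoint b D r∈B r∈D) ⟩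
        ∣ F ∣ ℕ.+ ∣ D′ ∣                            ≤⟨ ℕ.+-monoˡ-≤ ∣ D′ ∣ (∣faulty∣≤f S) ⟩
        f ℕ.+ ∣ D′ ∣                                ∎
      released≥ : quota (not b) (f ∸ ∣ D ∣) ℕ.≤ ∣ Released ∣ ℕ.+ quota (not b) (f ∸ ∣ D′ ∣)
      released≥ = begin
        quota (not b) (f ∸ ∣ D ∣)                        ≤⟨ ∣retained∣≥ (not b) D ∣D∣≤f ⟩
        ∣ retained (not b) D ∣                           ≤⟨ ∣p∣≤∣p─q∣+∣q∣ (retained (not b) D) _ ⟩
        ∣ Released ∣ ℕ.+ ∣ retained (not b) D′ ∣         ≤⟨ ℕ.+-monoʳ-≤ ∣ Released ∣ (∣retained∣≤ (not b) D′) ⟩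
        ∣ Released ∣ ℕ.+ quota (not b) (f ∸ ∣ D′ ∣)      ∎
      2f<2f : f ℕ.+ f ℕ.< f ℕ.+ f
      2f<2f = begin-strict
        f ℕ.+ f
          <⟨ budget-exceeded b f (∣ D ∣) (∣ D′ ∣) (∣ Released ∣) ∣D∣≤f flagged≤ released≥ ⟩
        ∣ D ∣ ℕ.+ (∣ D ∣ ℕ.+ (quota b (f ∸ ∣ D ∣) ℕ.+ ∣ Released ∣))
          ≤⟨ ℕ.+-monoʳ-≤ ∣ D ∣ (ℕ.+-monoʳ-≤ ∣ D ∣ (ℕ.≤-trans (ℕ.+-monoˡ-≤ ∣ Released ∣ quota≤B)
               (disjoint⇒∣p∣+∣q∣≤∣p∪q∣ B Released B-Released-disjoint))) ⟩
        ∣ D ∣ ℕ.+ (∣ D ∣ ℕ.+ ∣ B ∪ Released ∣)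
          ≤⟨ count-twice D⊆faulty D⊆F′ B∪R⊆ D-disjoint ⟩
        ∣ F ∣ ℕ.+ ∣ F′ ∣
          ≤⟨ ℕ.+-mono-≤ (∣faulty∣≤f S) (∣faulty∣≤f S′) ⟩
        f ℕ.+ f ∎

  agree-sym : ∀ {t u} {h h′ : History n} → u ≤ t → AgreeUpTo t h h′ → AgreeUpTo u h′ h
  agree-sym u≤t agree r 0≤v v≤u = sym (agree r 0≤v (≤-trans v≤u u≤t))

  search-time : ∀ d → 0# < d → SearchTimeAtMost algorithm d (thrice d)
  search-time d 0<d S at-distance = (r , d , r∉ , 0≤d , ≤thrice 0≤d , B-announces r∈ r∉) , certain
    where
    0≤d : 0# ≤ d
    0≤d = proj₁ 0<d
    on-some-ray : ∃[ b ] target S ≡ ray b d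
    on-some-ray = [ (λ e → true , e) , (λ e → false , e) ]′ at-distance
    b = proj₁ on-some-ray
    S-target = proj₂ on-some-ray
    open FirstVisit S b d 0≤d S-target
    r  = proj₁ reliable-visitor
    r∈ = proj₁ (proj₂ reliable-visitor)
    r∉ = proj₂ (proj₂ reliable-visitor)
    certain : Certain S (thrice d)
    certain S′ agree with em {target S′ ≡ target S}
    ... | yes same = same
    -- Only agreement up to three times the smaller distance is used, so the scenarios exchange
    -- roles when the target of `S′` is the nearer one.
    ... | no differ with b′ , d′ , 0≤d′ , S′-target ← ray-surjective (target S′) | total d d′
    ...   | inj₁ d≤d′ = Indistinguishable.absurd S S′ b b′ d d′ 0≤d d≤d′ S-target S′-target (differ ∘ sym) agree
    ...   | inj₂ d′≤d = Indistinguishable.absurd S′ S b′ b d′ d 0≤d′ d′≤d S′-target S-target differ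
                          (agree-sym {h = history S} (thrice-mono d′≤d) agree)

-- Finiteness of the set of robots in directed form: individual witnesses are joined one at a time.
-- `common-earlier` and `common-later` use it for the two directions of time, keeping the strict
-- inequality with `τ`.
common-bound : ∀ {n} {W : Set} {_⊑_ : W → W → Set} {Q : Fin n → W → Set} →
               W → (∀ a b → ∃[ c ] a ⊑ c × b ⊑ c) → (∀ {r a b} → a ⊑ b → Q r a → Q r b) →
               (∀ r → ∃ (Q r)) → ∃[ w ] ∀ r → Q r w
common-bound {zero}  w₀ join mono each = w₀ , λ ()
common-bound {suc n} w₀ join mono each =
  let a , Qa = each zero
      b , Qb = common-bound w₀ join mono (each ∘ suc)
      c , a⊑c , b⊑c = join a b
  in c , λ { zero → mono a⊑c Qa ; (suc r) → mono b⊑c (Qb r) }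

-- Consequences of the speed limit.

module Motions (em : ExcludedMiddle 0ℓ) (real : CompleteOrderedField) where
  open Reals em real
  open LineSearch real hiding (0#; ℝ; _<_)

  common-earlier : ∀ {n τ} {Q : Fin n → ℝ → Set} → (∀ {r a b} → a ≤ b → Q r a → Q r b) →
                   ∃ (_< τ) → (∀ r → ∃[ s ] s < τ × Q r s) → ∃[ s ] s < τ × ∀ r → Q r s
  common-earlier {τ = τ} {Q} mono w₀ each =
    let (s , s<τ) , Qs = common-bound {W = ∃ (_< τ)} {_⊑_ = λ a b → proj₁ a ≤ proj₁ b} {Q = λ r → Q r ∘ proj₁}
                           w₀ join mono (λ r → let s , s<τ , Qs = each r in (s , s<τ) , Qs)
    in s , s<τ , Qs
    where
    join : ∀ (a b : ∃ (_< τ)) → ∃[ c ] proj₁ a ≤ proj₁ c × proj₁ b ≤ proj₁ c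
    join a b with total (proj₁ a) (proj₁ b)
    ... | inj₁ a≤b = b , a≤b , ≤-refl
    ... | inj₂ b≤a = a , ≤-refl , b≤a

  common-later : ∀ {n τ T} {Q : Fin n → ℝ → Set} → (∀ {r a b} → b ≤ a → Q r a → Q r b) →
                 τ < T → (∀ r → ∃[ u ] τ < u × Q r u) → ∃[ u ] τ < u × u ≤ T × ∀ r → Q r u
  common-later {τ = τ} {T} {Q} mono τ<T each =
    let w , Qw = common-bound {W = ∃ (τ <_)} {_⊑_ = λ a b → proj₁ b ≤ proj₁ a} {Q = λ r → Q r ∘ proj₁}
                           (T , τ<T) join mono (λ r → let u , τ<u , Qu = each r in (u , τ<u) , Qu)
        (u , τ<u) , u≤w , u≤T = join w (T , τ<T)
    in u , τ<u , u≤T , λ r → mono u≤w (Qw r)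
    where
    join : ∀ (a b : ∃ (τ <_)) → ∃[ c ] proj₁ c ≤ proj₁ a × proj₁ c ≤ proj₁ b
    join a b with total (proj₁ a) (proj₁ b)
    ... | inj₁ a≤b = a , ≤-refl , a≤b
    ... | inj₂ b≤a = b , b≤a , ≤-refl

  module _ {p : Motion} (p-motion : IsMotion p) where
    open IsMotion p-motion

    position≤time : ∀ {t} → 0# ≤ t → p t ≤ t
    position≤time {t} 0≤t = linear (p t ∷ p 0# ∷ t ∷ [])
      (λ pt p0 t → (pt ⊕ ⊝ p0 , t ⊕ ⊝ O) ⇒ (p0 , O) ⇒ pt ≲ t) refl
      (proj₁ (speed≤1 ≤-refl 0≤t)) (≤-reflexive start)

    -position≤time : ∀ {t} → 0# ≤ t → - p t ≤ t
    -position≤time {t} 0≤t = linear (p t ∷ p 0# ∷ t ∷ [])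
      (λ pt p0 t → (p0 ⊕ ⊝ pt , t ⊕ ⊝ O) ⇒ (O , p0) ⇒ ⊝ pt ≲ t) refl
      (proj₂ (speed≤1 ≤-refl 0≤t)) (≤-reflexive (sym start))

    -- The witness is the time at which full speed from `p τ` would first lead to `e`.
    avoids-for-a-while : ∀ {τ e} → 0# ≤ τ → p τ ≢ e → ∃[ u ] τ < u × ∀ {t} → τ ≤ t → t < u → p t ≢ e
    avoids-for-a-while {τ} {e} 0≤τ p≢e with total (p τ) e
    ... | inj₁ p≤e = τ + (e - p τ) ,
      ≰⇒> (λ u≤τ → p≢e (≤-antisym p≤e
        (linear (τ ∷ e ∷ p τ ∷ []) (λ τ e p → (τ ⊕ (e ⊕ ⊝ p) , τ) ⇒ e ≲ p) refl u≤τ))) ,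
      λ { {t} τ≤t t<u refl → <⇒≱ t<u
        (linear (τ ∷ p t ∷ p τ ∷ t ∷ []) (λ τ e p t → (e ⊕ ⊝ p , t ⊕ ⊝ τ) ⇒ τ ⊕ (e ⊕ ⊝ p) ≲ t) refl
          (proj₁ (speed≤1 0≤τ τ≤t))) }
    ... | inj₂ e≤p = τ + (p τ - e) ,
      ≰⇒> (λ u≤τ → p≢e (≤-antisym
        (linear (τ ∷ e ∷ p τ ∷ []) (λ τ e p → (τ ⊕ (p ⊕ ⊝ e) , τ) ⇒ p ≲ e) refl u≤τ) e≤p)) ,
      λ { {t} τ≤t t<u refl → <⇒≱ t<u
        (linear (τ ∷ p t ∷ p τ ∷ t ∷ []) (λ τ e p t → (p ⊕ ⊝ e , t ⊕ ⊝ τ) ⇒ τ ⊕ (p ⊕ ⊝ e) ≲ t) refl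
          (proj₂ (speed≤1 0≤τ τ≤t))) }

    -- Reaching the first point takes time `d`, and crossing to the other takes `d + d` more.
    both-sides-ordered : ∀ b {d u v} → 0# ≤ u → u ≤ v → p u ≡ ray b d → p v ≡ ray (not b) d → thrice d ≤ v
    both-sides-ordered true {d} {u} {v} 0≤u u≤v at at′ =
      linear (d ∷ u ∷ v ∷ p u ∷ p v ∷ []) (λ d u v pu pv →
          (pu , u) ⇒ (d , pu) ⇒ (d , pu) ⇒ (pv , ⊝ d) ⇒ (pu ⊕ ⊝ pv , v ⊕ ⊝ u) ⇒ d ⊕ d ⊕ d ≲ v) refl
        (position≤time 0≤u) (≤-reflexive (sym at)) (≤-reflexive (sym at)) (≤-reflexive at′) (proj₂ (speed≤1 0≤u u≤v))
    both-sides-ordered false {d} {u} {v} 0≤u u≤v at at′ =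
      linear (d ∷ u ∷ v ∷ p u ∷ p v ∷ []) (λ d u v pu pv →
          (⊝ pu , u) ⇒ (pu , ⊝ d) ⇒ (pu , ⊝ d) ⇒ (d , pv) ⇒ (pv ⊕ ⊝ pu , v ⊕ ⊝ u) ⇒ d ⊕ d ⊕ d ≲ v) refl
        (-position≤time 0≤u) (≤-reflexive at) (≤-reflexive at) (≤-reflexive (sym at′)) (proj₁ (speed≤1 0≤u u≤v))

    both-sides : ∀ b {d u v} → 0# ≤ u → 0# ≤ v → p u ≡ ray b d → p v ≡ ray (not b) d → u < thrice d → thrice d ≤ v
    both-sides b {d} {u} {v} 0≤u 0≤v at at′ u<3d with total u v
    ... | inj₁ u≤v = both-sides-ordered b 0≤u u≤v at at′
    ... | inj₂ v≤u = contradiction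
      (both-sides-ordered (not b) 0≤v v≤u at′ (trans at (cong (λ c → ray c d) (sym (not-involutive b))))) (<⇒≱ u<3d)

  module _ {p q : Motion} (p-motion : IsMotion p) (q-motion : IsMotion q) {τ : ℝ} (0≤τ : 0# ≤ τ)
           (agree : ∀ {t} → 0# ≤ t → t < τ → p t ≡ q t) where

    private
      module P = IsMotion p-motion
      module Q = IsMotion q-motion

    -- By the speed limit the gap at `τ` is at most twice `τ - t` for every earlier `t`. Taking
    -- `τ - t` at most a quarter of the gap bounds the gap by half of itself.
    limit-≤ : p τ ≤ q τ
    limit-≤ with ≤⊎> (p τ) (q τ)
    ... | inj₁ p≤q = p≤q
    ... | inj₂ q<p = contradiction gap≤0 gap≰0
      where
      gap = p τ - q τ
      h = proj₁ (halve gap)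
      k = proj₁ (halve h)
      gap≰0 : ¬ gap ≤ 0#
      gap≰0 gap≤0 = <⇒≱ q<p (linear (p τ ∷ q τ ∷ []) (λ p q → (p ⊕ ⊝ q , O) ⇒ p ≲ q) refl gap≤0)
      gap≤ : ∀ {t} → 0# ≤ t → t < τ → gap ≤ (τ - t) + (τ - t)
      gap≤ {t} 0≤t t<τ = linear (p τ ∷ q τ ∷ p t ∷ q t ∷ τ ∷ t ∷ []) (λ p q p′ q′ τ t →
          (p ⊕ ⊝ p′ , τ ⊕ ⊝ t) ⇒ (q′ ⊕ ⊝ q , τ ⊕ ⊝ t) ⇒ (p′ , q′) ⇒ p ⊕ ⊝ q ≲ (τ ⊕ ⊝ t) ⊕ (τ ⊕ ⊝ t)) refl
        (proj₁ (P.speed≤1 0≤t (proj₁ t<τ))) (proj₂ (Q.speed≤1 0≤t (proj₁ t<τ))) (≤-reflexive (agree 0≤t t<τ))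
      k≰0 : ¬ k ≤ 0#
      k≰0 k≤0 = gap≰0 (linear (k ∷ h ∷ gap ∷ []) (λ k h g →
          (k , O) ⇒ (k , O) ⇒ (k , O) ⇒ (k , O) ⇒ (h , k ⊕ k) ⇒ (h , k ⊕ k) ⇒ (g , h ⊕ h) ⇒ g ≲ O) refl
        k≤0 k≤0 k≤0 k≤0 (≤-reflexive (sym (proj₂ (halve h)))) (≤-reflexive (sym (proj₂ (halve h)))) (≤-reflexive (sym (proj₂ (halve gap)))))
      close : ∃[ t ] 0# ≤ t × t < τ × τ - t ≤ k
      close with total 0# (τ - k)
      ... | inj₁ 0≤τ-k = τ - k , 0≤τ-k ,
        ≰⇒> (λ le → k≰0 (linear (τ ∷ k ∷ []) (λ τ k → (τ , τ ⊕ ⊝ k) ⇒ k ≲ O) refl le)) ,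
        linear (τ ∷ k ∷ []) (λ τ k → τ ⊕ ⊝ (τ ⊕ ⊝ k) ≲ k) refl
      ... | inj₂ τ-k≤0 = 0# , ≤-refl , ≰⇒> τ≰0 ,
        linear (τ ∷ k ∷ []) (λ τ k → (τ ⊕ ⊝ k , O) ⇒ τ ⊕ ⊝ O ≲ k) refl τ-k≤0
        where
        -- At `τ = 0` there is no earlier time to compare, but both motions start at the origin.
        τ≰0 : ¬ τ ≤ 0#
        τ≰0 τ≤0 with refl ← ≤-antisym τ≤0 0≤τ = <⇒≱ q<p (≤-reflexive (trans P.start (sym Q.start)))
      gap≤0 : gap ≤ 0#
      gap≤0 with t , 0≤t , t<τ , τ-t≤k ← close =
        linear (τ ∷ t ∷ k ∷ h ∷ gap ∷ []) (λ τ t k h g →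
            (g , (τ ⊕ ⊝ t) ⊕ (τ ⊕ ⊝ t)) ⇒ (g , (τ ⊕ ⊝ t) ⊕ (τ ⊕ ⊝ t)) ⇒ (τ ⊕ ⊝ t , k) ⇒ (τ ⊕ ⊝ t , k) ⇒ (τ ⊕ ⊝ t , k) ⇒ (τ ⊕ ⊝ t , k) ⇒
            (k ⊕ k , h) ⇒ (k ⊕ k , h) ⇒ (h ⊕ h , g) ⇒ g ≲ O) refl
          (gap≤ 0≤t t<τ) (gap≤ 0≤t t<τ) τ-t≤k τ-t≤k τ-t≤k τ-t≤k
          (≤-reflexive (proj₂ (halve h))) (≤-reflexive (proj₂ (halve h))) (≤-reflexive (proj₂ (halve gap)))

  limit-≡ : ∀ {p q} → IsMotion p → IsMotion q → ∀ {τ} → 0# ≤ τ →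
            (∀ {t} → 0# ≤ t → t < τ → p t ≡ q t) → p τ ≡ q τ
  limit-≡ p-motion q-motion 0≤τ agree = ≤-antisym (limit-≤ p-motion q-motion 0≤τ agree)
    (limit-≤ q-motion p-motion 0≤τ λ 0≤t t<τ → sym (agree 0≤t t<τ))

-- Lower bound: the adversary against an arbitrary algorithm.

module Lower (em : ExcludedMiddle 0ℓ) (real : CompleteOrderedField)
             {n f : ℕ} (size : n ≡ suc f ℕ.+ (f ℕ.+ f)) (A : LineSearch.SearchAlgorithm real n f) where
  open Reals em real
  open Collect em
  open Scenarios em real
  open Motions em real
  open LineSearch real hiding (0#; ℝ; _<_)
  open SearchAlgorithm A
  open Strategy strategy
  open Scenario hiding (isMotion)

  silence : History n
  silence _ _ = nothing

  quietMotion : Fin n → Motion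
  quietMotion = trajectory silence

  visitedBy visitedBefore : ℝ → ℝ → Subset n
  visitedBy     e t = collect λ r → ∃[ u ] 0# ≤ u × u ≤ t × quietMotion r u ≡ e
  visitedBefore e t = collect λ r → ∃[ u ] 0# ≤ u × u < t × quietMotion r u ≡ e

  module Crowding (e T : ℝ) (0≤T : 0# ≤ T) where

    Crowded : ℝ → Set
    Crowded t = f ℕ.< ∣ visitedBy e t ∣

    τ : ℝ
    τ = firstTime Crowded T

    0≤τ : 0# ≤ τ
    0≤τ = 0≤firstTime Crowded T 0≤T

    -- For finitely many robots, visits strictly before `τ` are all made by some time still before
    -- `τ`; with more than `f` visitors the point would already be crowded then.
    ∣visitedBefore∣≤f : ∣ visitedBefore e τ ∣ ℕ.≤ f
    ∣visitedBefore∣≤f = ℕ.≮⇒≥ absurd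
      where
      absurd : ¬ f ℕ.< ∣ visitedBefore e τ ∣
      absurd crowd =
        -- A crowd is nonempty; the visiting time of one member serves as default for the robots
        -- that do not visit.
        let r₀ , r₀∈ , _ = ∣q∣<∣p∣⇒p⊈q (visitedBefore e τ) ∅
                             (ℕ.≤-<-trans (ℕ.≤-reflexive (∣⊥∣≡0 n)) (ℕ.≤-<-trans ℕ.z≤n crowd))
            s₀ , 0≤s₀ , s₀<τ , _ = ∈-collect⁻ r₀∈
            s , s<τ , visited = common-earlier {Q = λ r s → 0# ≤ s × (r ∈ visitedBefore e τ → r ∈ visitedBy e s)}
              (λ a≤b (0≤a , visit) → ≤-trans 0≤a a≤b ,
                 collect-mono (λ _ (u , 0≤u , u≤a , at) → u , 0≤u , ≤-trans u≤a a≤b , at) ∘ visit)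
              (s₀ , s₀<τ) (each s₀ 0≤s₀ s₀<τ)
            0≤s = proj₁ (visited r₀)
        in <⇒≱ s<τ (firstTime-lower Crowded T 0≤s (≤-trans (proj₁ s<τ) (firstTime≤ Crowded T))
             (ℕ.<-≤-trans crowd (p⊆q⇒∣p∣≤∣q∣ λ {r} → proj₂ (visited r))))
        where
        each : ∀ s₀ → 0# ≤ s₀ → s₀ < τ →
               ∀ r → ∃[ s ] s < τ × 0# ≤ s × (r ∈ visitedBefore e τ → r ∈ visitedBy e s)
        each s₀ 0≤s₀ s₀<τ r with r ∈? visitedBefore e τ
        ... | no r∉ = s₀ , s₀<τ , 0≤s₀ , λ r∈ → contradiction r∈ r∉
        ... | yes r∈ with u , 0≤u , u<τ , at ← ∈-collect⁻ r∈ =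
          u , u<τ , 0≤u , λ _ → ∈-collect⁺ (u , 0≤u , ≤-refl , at)

    -- Below the cap the infimum is attained. By continuity the robots that have not reached `e` by
    -- `τ` avoid it until some common later time, and a crowded time before that has no visitors
    -- beyond those counted at `τ`.
    crowded-at-τ : τ < T → Crowded τ
    crowded-at-τ τ<T =
      let u , τ<u , u≤T , avoid = common-later mono τ<T each
          t , 0≤t , t<u , crowded = firstTime-approx Crowded T u≤T τ<u
      in ℕ.<-≤-trans crowded (p⊆q⇒∣p∣≤∣q∣ λ {r} (r∈ : r ∈ visitedBy e t) →
           let v , 0≤v , v≤t , at = ∈-collect⁻ r∈ in
           [ (λ r∈τ → r∈τ) , (λ never → contradiction at (never 0≤v (≤-<-trans v≤t t<u))) ]′ (avoid r))
      where
      Avoid : Fin n → ℝ → Set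
      Avoid r u = r ∈ visitedBy e τ ⊎ (∀ {t} → 0# ≤ t → t < u → quietMotion r t ≢ e)
      mono : ∀ {r a b} → b ≤ a → Avoid r a → Avoid r b
      mono b≤a (inj₁ r∈)    = inj₁ r∈
      mono b≤a (inj₂ never) = inj₂ λ 0≤t t<b → never 0≤t (<-≤-trans t<b b≤a)
      each : ∀ r → ∃[ u ] τ < u × Avoid r u
      each r with r ∈? visitedBy e τ
      ... | yes r∈ = T , τ<T , inj₁ r∈
      ... | no r∉ =
        let u , τ<u , away = avoids-for-a-while (isMotion silence r) {e = e} 0≤τ
                               (λ at → r∉ (∈-collect⁺ (τ , 0≤τ , ≤-refl , at)))
        in u , τ<u , inj₂ λ {t} 0≤t t<u at →
             [ (λ t≤τ → r∉ (∈-collect⁺ (t , 0≤t , t≤τ , at))) , (λ τ≤t → away τ≤t t<u at) ]′ (total t τ)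

  module SilentFaults
    (e τ : ℝ) (0≤τ : 0# ≤ τ) (S : Scenario strategy f) (S-target : target S ≡ e)
    (early∈faulty : visitedBefore e τ ⊆ faulty S)
    (mute : ∀ {r t} → r ∈ faulty S → 0# ≤ t → announces S r t ≡ false) where

    mute-history : ∀ {r t} → r ∈ faulty S → 0# ≤ t → history S r t ≡ nothing
    mute-history {r} {t} r∈ 0≤t = cong (λ b → if b then just (motion S r t) else nothing) (mute r∈ 0≤t)

    silent-or-there : ∀ r {t} → 0# ≤ t → history S r t ≡ nothing ⊎ r ∉ faulty S × motion S r t ≡ e
    silent-or-there r {t} 0≤t with r ∈? faulty S
    ... | yes r∈ = inj₁ (mute-history r∈ 0≤t)
    ... | no r∉ with announces S r t in eq
    ...   | false = inj₁ refl
    ...   | true  = inj₂ (r∉ , trans (Equivalence.to (truthful S r∉ 0≤t) eq) S-target)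

    Noise : ℝ → Set
    Noise t = ∃[ r ] history S r t ≢ nothing

    SilentBefore : ℝ → Set
    SilentBefore t = ∀ r {u} → 0# ≤ u → u < t → history S r u ≡ nothing

    -- At time `t` itself there may be messages, so causality yields agreement only before `t`;
    -- `limit-≡` extends it to `t`.
    motion-quiet : ∀ {t} → 0# ≤ t → SilentBefore t → ∀ {r} → r ∉ faulty S → motion S r t ≡ quietMotion r t
    motion-quiet 0≤t silent {r} r∉ = limit-≡ (Scenario.isMotion S r) (isMotion silence r) 0≤t λ 0≤u u<t →
      trans (follows S r∉ 0≤u) (causal 0≤u (λ r′ 0≤v v≤u → silent r′ 0≤v (≤-<-trans v≤u u<t)) r)

    -- Suppose that the infimum `σ` of the noisy times is below `τ`. Up to and including `σ`
    -- reliable robots move as in the silent run, and since early visitors are faulty, none of them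
    -- is at `e` at time `σ`. They stay away for a while, so no noise can set in at `σ` or right
    -- after it.
    silent-before-τ : SilentBefore τ
    silent-before-τ with ≤⊎> τ (firstTime Noise τ)
    ... | inj₁ τ≤σ = λ r {t} 0≤t t<τ → decidable-stable em λ noise →
      <⇒≱ t<τ (≤-trans τ≤σ (firstTime-lower Noise τ 0≤t (proj₁ t<τ) (r , noise)))
    ... | inj₂ σ<τ =
      let u , σ<u , u≤τ , quiet = common-later {Q = λ r u → ∀ {t} → σ ≤ t → t < u → history S r t ≡ nothing}
                                    (λ b≤a quiet σ≤t t<b → quiet σ≤t (<-≤-trans t<b b≤a)) σ<τ each
          t , 0≤t , t<u , r , noise = firstTime-approx Noise τ u≤τ σ<u
      in contradiction (quiet r (firstTime-lower Noise τ 0≤t (≤-trans (proj₁ t<u) u≤τ) (r , noise)) t<u) noise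
      where
      σ = firstTime Noise τ
      0≤σ : 0# ≤ σ
      0≤σ = 0≤firstTime Noise τ 0≤τ
      silent-before-σ : SilentBefore σ
      silent-before-σ r 0≤t t<σ = decidable-stable em λ noise →
        <⇒≱ t<σ (firstTime-lower Noise τ 0≤t (≤-trans (proj₁ t<σ) (firstTime≤ Noise τ)) (r , noise))
      each : ∀ r → ∃[ u ] σ < u × (∀ {t} → σ ≤ t → t < u → history S r t ≡ nothing)
      each r with r ∈? faulty S
      ... | yes r∈ = τ , σ<τ , λ σ≤t _ → mute-history r∈ (≤-trans 0≤σ σ≤t)
      ... | no r∉ =
        let u , σ<u , away = avoids-for-a-while (Scenario.isMotion S r) {e = e} 0≤σ (λ at →
              r∉ (early∈faulty (∈-collect⁺ (σ , 0≤σ , σ<τ , trans (sym (motion-quiet 0≤σ silent-before-σ r∉)) at))))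
        in u , σ<u , λ σ≤t t<u →
             [ (λ silent → silent) , (λ reached → contradiction (proj₂ reached) (away σ≤t t<u)) ]′
               (silent-or-there r (≤-trans 0≤σ σ≤t))

    motion-quiet-until-τ : ∀ {t} → 0# ≤ t → t ≤ τ → ∀ {r} → r ∉ faulty S → motion S r t ≡ quietMotion r t
    motion-quiet-until-τ 0≤t t≤τ = motion-quiet 0≤t λ r 0≤u u<t → silent-before-τ r 0≤u (<-≤-trans u<t t≤τ)

  module _ {d T : ℝ} (0<d : 0# < d) (T<3d : T < thrice d) where

    0≤d : 0# ≤ d
    0≤d = proj₁ 0<d

    -- The announcers G may just as well be the faulty ones, the target being out of reach.
    uncertain : (S : Scenario strategy f) → ∀ b → target S ≡ ray b d → (G : Subset n) → ∣ G ∣ ℕ.≤ f →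
                (∀ {r t} → r ∉ G → 0# ≤ t → t ≤ T → history S r t ≡ nothing) → ¬ Certain S T
    uncertain S b S-target G ∣G∣≤f silent certain =
      contradiction (ray-time true b (0≤thrice 0≤d) 0≤d (trans (sym S′-target) (trans (certain S′ agree) S-target))) λ 3d≡d →
        <⇒≱ 0<d (linear (d ∷ []) (λ d → (d ⊕ d ⊕ d , d) ⇒ (O , d) ⇒ d ≲ O) refl (≤-reflexive 3d≡d) 0≤d)
      where
      3d≢0 : thrice d ≢ 0#
      3d≢0 3d≡0 = <⇒≱ 0<d (linear (d ∷ []) (λ d → (d ⊕ d ⊕ d , O) ⇒ (O , d) ⇒ (O , d) ⇒ d ≲ O) refl (≤-reflexive 3d≡0) 0≤d 0≤d)
      -- The robots of `G` copy `S`; a target at `thrice d` cannot be reached by time `T`, so the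
      -- others keep silent.
      imitation = wellPosed (thrice d) 3d≢0 G ∣G∣≤f (motion S) (Scenario.isMotion S) (announces S)
      S′ : Scenario strategy f
      S′ = proj₁ imitation
      S′-target : target S′ ≡ thrice d
      S′-target = proj₁ (proj₂ imitation)
      S′-faulty : faulty S′ ≡ G
      S′-faulty = proj₁ (proj₂ (proj₂ imitation))
      agree : AgreeUpTo T (history S) (history S′)
      agree r {t} 0≤t t≤T with r ∈? G
      ... | yes r∈ =
        let same-motion , same-announces = proj₂ (proj₂ (proj₂ imitation)) r∈ 0≤t
        in sym (cong₂ (λ b p → if b then just p else nothing) same-announces same-motion)
      ... | no r∉ with announces S′ r t in eq
      ...   | false = silent r∉ 0≤t t≤T
      ...   | true  = contradiction
        (subst (_≤ t) (trans (Equivalence.to (truthful S′ (subst (r ∉_) (sym S′-faulty) r∉) 0≤t) eq) S′-target)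
          (position≤time (Scenario.isMotion S′ r) 0≤t))
        (<⇒≱ (≤-<-trans t≤T T<3d))

    module Side (b : Bool) where

      open Crowding (ray b d) (thrice d) (0≤thrice 0≤d) public

      target≢0# : ray b d ≢ 0#
      target≢0# e≡0 = proj₂ 0<d (sym (ray-time b b 0≤d ≤-refl (trans e≡0 (sym (ray-0 b)))))

      early : Subset n
      early = visitedBefore (ray b d) τ

      module _ (F : Subset n) (∣F∣≤f : ∣ F ∣ ℕ.≤ f) (early⊆F : early ⊆ F) where

        private
          construction = wellPosed (ray b d) target≢0# F ∣F∣≤f quietMotion (isMotion silence) (λ _ _ → false)

        scenario : Scenario strategy f
        scenario = proj₁ construction

        scenario-target : target scenario ≡ ray b d
        scenario-target = proj₁ (proj₂ construction)

        scenario-faulty : faulty scenario ≡ F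
        scenario-faulty = proj₁ (proj₂ (proj₂ construction))

        open SilentFaults (ray b d) τ 0≤τ scenario scenario-target
          (λ r∈ → subst (_ ∈_) (sym scenario-faulty) (early⊆F r∈))
          (λ r∈ 0≤t → proj₂ (proj₂ (proj₂ (proj₂ construction)) (subst (_ ∈_) scenario-faulty r∈) 0≤t)) public

        exposed : ∀ G → ∣ G ∣ ℕ.≤ f → (∀ {r t} → r ∉ G → 0# ≤ t → t ≤ T → history scenario r t ≡ nothing) →
                  ¬ SearchTimeAtMost A d T
        exposed G ∣G∣≤f silent finishes =
          uncertain scenario b scenario-target G ∣G∣≤f silent (proj₂ (finishes scenario (at-distance b scenario-target)))
          where
          at-distance : ∀ b {x} → x ≡ ray b d → x ≡ d ⊎ x ≡ - d
          at-distance true  = inj₁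
          at-distance false = inj₂

        -- Up to `τ` reliable robots move as in the silent run, so one that has been at the opposite
        -- point by then cannot also reach the target before `thrice d`.
        silent-if-elsewhere : τ < thrice d → ∀ {G} →
          (∀ {r} → r ∉ G → r ∉ F → ∃[ v ] 0# ≤ v × v ≤ τ × quietMotion r v ≡ ray (not b) d) →
          ∀ {r t} → r ∉ G → 0# ≤ t → t ≤ T → history scenario r t ≡ nothing
        silent-if-elsewhere τ<3d elsewhere {r} r∉G 0≤t t≤T with silent-or-there r 0≤t
        ... | inj₁ quiet = quiet
        ... | inj₂ (r∉faulty , reached) =
          let v , 0≤v , v≤τ , at = elsewhere r∉G (subst (r ∉_) scenario-faulty r∉faulty)
          in contradiction
               (both-sides (Scenario.isMotion scenario r) b 0≤t 0≤v reached
                 (trans (motion-quiet-until-τ 0≤v v≤τ r∉faulty) at) (≤-<-trans t≤T T<3d))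
               (<⇒≱ (≤-<-trans v≤τ τ<3d))

      -- The at most `f` robots that reach the point before `thrice d` in the silent run are made
      -- faulty and mute. Nobody announces anything by `T`, so the set to be blamed is empty.
      late : thrice d ≤ τ → ¬ SearchTimeAtMost A d T
      late 3d≤τ = exposed early ∣visitedBefore∣≤f (λ r∈ → r∈) ∅ (subst (ℕ._≤ f) (sym (∣⊥∣≡0 n)) ℕ.z≤n)
        λ {r} _ 0≤t t≤T → silent-before-τ early ∣visitedBefore∣≤f (λ r∈ → r∈) r 0≤t
          (<-≤-trans (≤-<-trans t≤T T<3d) 3d≤τ)

      crowded : τ < thrice d → (others : Subset n) → ∣ others ∣ ≡ suc f →
                (∀ {r} → r ∈ others → ∃[ v ] 0# ≤ v × v ≤ τ × quietMotion r v ≡ ray (not b) d) →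
                ¬ SearchTimeAtMost A d T
      crowded τ<3d others ∣others∣ visit = λ finishes →
        -- `F` is padded to exactly `f` elements of the `f + f` in `R`, so that at most `f` possible
        -- announcers are left to blame.
        let F , early⊆F , F⊆R , ∣F∣≡f = between early R f early⊆R ∣visitedBefore∣≤f (subst (f ℕ.≤_) (sym ∣R∣) (ℕ.m≤m+n f f))
            ∣F∣≤f = ℕ.≤-reflexive ∣F∣≡f
        in exposed F ∣F∣≤f early⊆F (R ─ F) (∣R─F∣≤f F F⊆R ∣F∣≡f)
             (silent-if-elsewhere F ∣F∣≤f early⊆F τ<3d λ r∉G r∉F → visit (x∉∁p⇒x∈p λ r∈R →
               r∉G (x∈p∧x∉q⇒x∈p─q r∈R r∉F)))
             finishes
        where
        R : Subset n
        R = ∁ others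
        ∣R∣ : ∣ R ∣ ≡ f ℕ.+ f
        ∣R∣ = trans (∣∁p∣≡n∸∣p∣ others) (trans (cong₂ _∸_ size ∣others∣) (ℕ.m+n∸m≡n (suc f) (f ℕ.+ f)))
        early⊆R : early ⊆ R
        early⊆R {r} r∈ = x∉p⇒x∈∁p λ r∈others →
          let u , 0≤u , u<τ , at = ∈-collect⁻ r∈
              v , 0≤v , v≤τ , at′ = visit r∈others
          in <⇒≱ (≤-<-trans v≤τ τ<3d)
               (both-sides (isMotion silence r) b 0≤u 0≤v at at′ (≤-<-trans (proj₁ u<τ) τ<3d))
        ∣R─F∣≤f : ∀ F → F ⊆ R → ∣ F ∣ ≡ f → ∣ R ─ F ∣ ℕ.≤ f
        ∣R─F∣≤f F F⊆R ∣F∣≡f = ℕ.+-cancelʳ-≤ f _ _ (begin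
          ∣ R ─ F ∣ ℕ.+ f        ≡⟨ cong (∣ R ─ F ∣ ℕ.+_) ∣F∣≡f ⟨
          ∣ R ─ F ∣ ℕ.+ ∣ F ∣    ≡⟨ ∣p─q∣+∣q∣≡∣p∪q∣ R F ⟩
          ∣ R ∪ F ∣              ≤⟨ p⊆q⇒∣p∣≤∣q∣ (λ r∈ → [ (λ r∈R → r∈R) , F⊆R ]′ (x∈p∪q⁻ R F r∈)) ⟩
          ∣ R ∣                  ≡⟨ ∣R∣ ⟩
          f ℕ.+ f                ∎)
          where open ℕ.≤-Reasoning

    -- The target is put at the point that is crowded last: if this happens before `thrice d`, the
    -- opposite time is below its cap as well, and `crowded-at-τ` applies to it.
    refutation : ∀ b → Side.τ (not b) ≤ Side.τ b → ¬ SearchTimeAtMost A d T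
    refutation b τ′≤τ with ≤⊎> (thrice d) (Side.τ b)
    ... | inj₁ 3d≤τ = Side.late b 3d≤τ
    -- The visitors are cut down to exactly `suc f`, so that `f + f` robots remain.
    ... | inj₂ τ<3d = Side.crowded b τ<3d (first (suc f) visitors)
        (∣first∣ (suc f) visitors (Side.crowded-at-τ (not b) (≤-<-trans τ′≤τ τ<3d)))
        λ {r} r∈ →
          let v , 0≤v , v≤τ′ , at = ∈-collect⁻ {r = r} (first⊆ (suc f) visitors r∈)
          in v , 0≤v , ≤-trans v≤τ′ τ′≤τ , at
      where
      visitors : Subset n
      visitors = visitedBy (ray (not b) d) (Side.τ (not b))

  search-time≥ : ∀ d → 0# < d → SearchTimeAtLeast A d (thrice d)
  search-time≥ d 0<d T finishes with ≤⊎> (thrice d) T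
  ... | inj₁ 3d≤T = 3d≤T
  ... | inj₂ T<3d with total (Side.τ 0<d T<3d true) (Side.τ 0<d T<3d false)
  ...   | inj₁ le = contradiction finishes (refutation 0<d T<3d false le)
  ...   | inj₂ le = contradiction finishes (refutation 0<d T<3d true le)

open import Data.Nat.Base using (_+_; _*_; _≤_)

lemma8 : ExcludedMiddle 0ℓ → (real : CompleteOrderedField) →
    let open LineSearch real in
    (f : ℕ) → 1 ≤ f →
    (Σ[ A ∈ SearchAlgorithm (3 * f + 1) f ] (∀ (d : ℝ) → 0# < d →
    SearchTimeAtMost A d (thrice d)))
    ×
    (∀ (d : ℝ) → 0# < d → ∀ (A : SearchAlgorithm (3 * f + 1) f) →
    SearchTimeAtLeast A d (thrice d))
lemma8 em real f 1≤f =
  (Upper.algorithm em real {f = f} (quota-sum f 1≤f) , Upper.search-time em real {f = f} (quota-sum f 1≤f)) ,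
  λ d 0<d A → Lower.search-time≥ em real size A d 0<d
  where
  open Data.Nat.Solver.+-*-Solver
  size : 3 * f + 1 ≡ suc f + (f + f)
  size = solve 1 (λ f → con 3 :* f :+ con 1 := con 1 :+ f :+ (f :+ f)) refl f
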